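{- Let $\varphi=(1+\sqrt5)/2$. For all integers $t\ge1$ and $n\ge3t+2\lceil\varphi t\rceil$, \[ f(n,t)\le 2\min_{p\in\{\lfloor\varphi t\rfloor,\lceil\varphi t\rceil\}} p\max\{t^2,(p+t)(2t-p)\} \le(1+\sqrt5)t^3+\left(1+\frac1{\sqrt5}\right)t^2 . \]
   Context: All graphs are finite and simple. $\mathcal{G}_3(n)$ denotes the family of tripartite graphs with $n$ vertices in each of the three parts (each part is an independent set). $\delta(G)$ is the minimum degree of $G$ and $\tau(G)$ is the number of triangles in $G$. For integers $1\le t\le n$, \[ f(n,t)=\min\{\tau(G): G\in\mathcal{G}_3(n),\ \delta(G)\ge n+t\}. \] -}

module Defs where

open import Data.Bool using (Bool; true; false; _∧_)
open import Data.Fin using (Fin; zero; suc)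
open import Data.Integer as ℤ using (ℤ; +_; -[1+_])
import Data.Integer.Properties as ℤ
open import Data.List using (List; []; _∷_; _++_; map; length; filter; filterᵇ; allFin; cartesianProduct; cartesianProductWith)
open import Data.List.Extrema.Nat using (min; min≤v⁺; v≤min⁺; argmin-sel)
open import Data.List.Membership.Propositional using (find)
open import Data.List.Membership.Propositional.Properties using (∈-map⁺; ∈-map⁻; ∈-filter⁺; ∈-filter⁻)
import Data.List.Properties as List
import Data.List.Relation.Unary.All as All
import Data.List.Relation.Unary.All.Properties as All
open import Data.List.Relation.Unary.Any as Any using (Any; here; there)
import Data.List.Relation.Unary.Any.Properties as Any
open import Data.Nat as ℕ using (ℕ; zero; suc)
import Data.Nat.Properties as ℕ
open import Data.Product using (∃; _×_; _,_; proj₁; proj₂)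
open import Data.Rational as ℚ using (ℚ; 0ℚ; 1ℚ; ½; _/_)
import Data.Rational.Properties as ℚ
import Data.Rational.Solver as ℚ
import Data.Rational.Unnormalised as ℚᵘ
import Data.Rational.Unnormalised.Properties as ℚᵘ
open import Data.Sum using (_⊎_; inj₁; inj₂)
open import Data.Vec.Functional as Vector using ()
open import Function using (_∘_)
open import Relation.Binary.PropositionalEquality
open import Relation.Nullary using (¬_; Dec; yes; no)
open import Relation.Nullary.Decidable using (_×-dec_; _⊎-dec_)

-- The vertex (i , a) is the a-th vertex of part i.

Vertex : ℕ → Set
Vertex n = Fin 3 × Fin n

vertices : ∀ n → List (Vertex n)
vertices n = cartesianProduct (allFin 3) (allFin n)

-- Loops are excluded by the case a = b of `independent`.

record 𝒢₃ (n : ℕ) : Set where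
  field
    adj         : Vertex n → Vertex n → Bool
    symmetric   : ∀ u v → adj u v ≡ adj v u
    independent : ∀ i a b → adj (i , a) (i , b) ≡ false

open 𝒢₃ public

count : {A : Set} → (A → Bool) → List A → ℕ
count P xs = length (filterᵇ P xs)

degree : ∀ {n} → 𝒢₃ n → Vertex n → ℕ
degree {n} G v = count (adj G v) (vertices n)

-- A degree never exceeds 3n, so the default value 3n of `min` only matters
-- for the graph without vertices.

δ : ∀ {n} → 𝒢₃ n → ℕ
δ {n} G = min (3 ℕ.* n) (map (degree G) (vertices n))

-- The two- and three-element sublists of a list.  For a list without
-- repetitions, such as `vertices n`, these are its two- and three-element
-- subsets, each listed exactly once.

pairs : {A : Set} → List A → List (A × A)
pairs []       = []
pairs (x ∷ xs) = map (x ,_) xs ++ pairs xs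

triples : {A : Set} → List A → List (A × A × A)
triples []       = []
triples (x ∷ xs) = map (x ,_) (pairs xs) ++ triples xs

isTriangle : ∀ {n} → 𝒢₃ n → Vertex n × Vertex n × Vertex n → Bool
isTriangle G (u , v , w) = adj G u v ∧ adj G u w ∧ adj G v w

τ : ∀ {n} → 𝒢₃ n → ℕ
τ {n} G = count (isTriangle G) (triples (vertices n))

-- A graph in 𝒢₃ n amounts to three arbitrary bipartite graphs between the
-- parts 0 and 1, 0 and 2, 1 and 2.

Bipartite : ℕ → Set
Bipartite n = Fin n → Fin n → Bool

pattern 0F = zero
pattern 1F = suc zero
pattern 2F = suc (suc zero)

glue : ∀ {n} → Bipartite n → Bipartite n → Bipartite n → 𝒢₃ n
glue {n} P Q R = record { adj = A ; symmetric = A-sym ; independent = A-ind }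
  where
  A : Vertex n → Vertex n → Bool
  A (0F , a) (0F , b) = false
  A (0F , a) (1F , b) = P a b
  A (0F , a) (2F , b) = Q a b
  A (1F , a) (0F , b) = P b a
  A (1F , a) (1F , b) = false
  A (1F , a) (2F , b) = R a b
  A (2F , a) (0F , b) = Q b a
  A (2F , a) (1F , b) = R b a
  A (2F , a) (2F , b) = false

  A-sym : ∀ u v → A u v ≡ A v u
  A-sym (0F , a) (0F , b) = refl
  A-sym (0F , a) (1F , b) = refl
  A-sym (0F , a) (2F , b) = refl
  A-sym (1F , a) (0F , b) = refl
  A-sym (1F , a) (1F , b) = refl
  A-sym (1F , a) (2F , b) = refl
  A-sym (2F , a) (0F , b) = refl
  A-sym (2F , a) (1F , b) = refl
  A-sym (2F , a) (2F , b) = refl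

  A-ind : ∀ i a b → A (i , a) (i , b) ≡ false
  A-ind 0F a b = refl
  A-ind 1F a b = refl
  A-ind 2F a b = refl

functions : {A : Set} (m : ℕ) → List A → List (Fin m → A)
functions zero    as = Vector.[] ∷ []
functions (suc m) as = cartesianProductWith Vector._∷_ as (functions m as)

bipartites : ∀ n → List (Bipartite n)
bipartites n = functions n (functions n (true ∷ false ∷ []))

allGraphs : ∀ n → List (𝒢₃ n)
allGraphs n =
  cartesianProductWith (λ { (P , Q) R → glue P Q R })
    (cartesianProduct (bipartites n) (bipartites n)) (bipartites n)

complete : ∀ n → 𝒢₃ n
complete n = glue all all all
  where
  all : Bipartite n
  all _ _ = true

-- f n t is the intended minimum whenever t ≤ n, see f-attained and f-minimal:
-- then the complete tripartite graph, which supplies the default value of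
-- `min`, has minimum degree at least n + t.  For t > n the value is junk.

f : ℕ → ℕ → ℕ
f n t = min (τ (complete n)) (map τ (filter (λ G → n ℕ.+ t ℕ.≤? δ G) (allGraphs n)))

_≈ᴳ_ : ∀ {n} → 𝒢₃ n → 𝒢₃ n → Set
G ≈ᴳ H = ∀ u v → adj G u v ≡ adj H u v

count-cong : {A : Set} {P Q : A → Bool} → (∀ x → P x ≡ Q x) → ∀ xs → count P xs ≡ count Q xs
count-cong eq []       = refl
count-cong {P = P} {Q} eq (x ∷ xs) with P x | Q x | eq x
... | true  | _ | refl = cong suc (count-cong eq xs)
... | false | _ | refl = count-cong eq xs

δ-cong : ∀ {n} {G H : 𝒢₃ n} → G ≈ᴳ H → δ G ≡ δ H
δ-cong {n} eq = cong (min (3 ℕ.* n)) (List.map-cong (λ v → count-cong (eq v) (vertices n)) (vertices n))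

τ-cong : ∀ {n} {G H : 𝒢₃ n} → G ≈ᴳ H → τ G ≡ τ H
τ-cong {n} eq = count-cong (λ { (u , v , w) → cong₂ _∧_ (eq u v) (cong₂ _∧_ (eq u w) (eq v w)) })
                           (triples (vertices n))

functions-complete : {A : Set} {R : A → A → Set} {as : List A} → (∀ a → Any (R a) as) →
  ∀ m (g : Fin m → A) → Any (λ h → ∀ i → R (g i) (h i)) (functions m as)
functions-complete c zero    g = here λ ()
functions-complete c (suc m) g =
  Any.cartesianProductWith⁺ Vector._∷_ (λ { p q zero → p ; p q (suc i) → q i })
    (c (g zero)) (functions-complete c m (g ∘ suc))

bipartites-complete : ∀ {n} (P : Bipartite n) → Any (λ Q → ∀ a b → P a b ≡ Q a b) (bipartites n)
bipartites-complete {n} = functions-complete (functions-complete bools n) n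
  where
  bools : ∀ b → Any (b ≡_) (true ∷ false ∷ [])
  bools true  = here refl
  bools false = there (here refl)

allGraphs-complete : ∀ {n} (G : 𝒢₃ n) → Any (G ≈ᴳ_) (allGraphs n)
allGraphs-complete {n} G =
  Any.cartesianProductWith⁺ _ (λ { (p , q) r → agree p q r })
    (Any.cartesianProductWith⁺ _,_ _,_
      (bipartites-complete (λ a b → adj G (0F , a) (1F , b)))
      (bipartites-complete (λ a b → adj G (0F , a) (2F , b))))
    (bipartites-complete (λ a b → adj G (1F , a) (2F , b)))
  where
  agree : ∀ {P Q R} → (∀ a b → adj G (0F , a) (1F , b) ≡ P a b)
                    → (∀ a b → adj G (0F , a) (2F , b) ≡ Q a b)
                    → (∀ a b → adj G (1F , a) (2F , b) ≡ R a b) → G ≈ᴳ glue P Q R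
  agree p q r (0F , a) (0F , b) = independent G 0F a b
  agree p q r (0F , a) (1F , b) = p a b
  agree p q r (0F , a) (2F , b) = q a b
  agree p q r (1F , a) (0F , b) = trans (symmetric G _ _) (p b a)
  agree p q r (1F , a) (1F , b) = independent G 1F a b
  agree p q r (1F , a) (2F , b) = r a b
  agree p q r (2F , a) (0F , b) = trans (symmetric G _ _) (q b a)
  agree p q r (2F , a) (1F , b) = trans (symmetric G _ _) (r b a)
  agree p q r (2F , a) (2F , b) = independent G 2F a b

f-minimal : ∀ {n t} (G : 𝒢₃ n) → n ℕ.+ t ℕ.≤ δ G → f n t ℕ.≤ τ G
f-minimal {n} {t} G h with find (allGraphs-complete G)
... | H , H∈ , eq =
  min≤v⁺ (τ (complete n)) _ (inj₂ (Any.map (λ { refl → ℕ.≤-reflexive (sym (τ-cong {G = G} {H} eq)) })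
    (∈-map⁺ τ (∈-filter⁺ (λ G → n ℕ.+ t ℕ.≤? δ G) H∈ (subst (n ℕ.+ t ℕ.≤_) (δ-cong {G = G} {H} eq) h)))))

count-++ : {A : Set} (P : A → Bool) (xs ys : List A) → count P (xs ++ ys) ≡ count P xs ℕ.+ count P ys
count-++ P []       ys = refl
count-++ P (x ∷ xs) ys with P x
... | true  = cong suc (count-++ P xs ys)
... | false = count-++ P xs ys

count-true : {A B : Set} (P : B → Bool) (g : A → B) → (∀ a → P (g a) ≡ true) →
  ∀ xs → count P (map g xs) ≡ length xs
count-true P g h []       = refl
count-true P g h (x ∷ xs) rewrite h x = cong suc (count-true P g h xs)

degree-complete : ∀ n v → n ℕ.+ n ℕ.≤ degree (complete n) v
degree-complete n (i , a) = subst (n ℕ.+ n ℕ.≤_) (sym split) (bound i a)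
  where
  cnt : Fin 3 → Fin n → Fin 3 → ℕ
  cnt i a j = count (adj (complete n) (i , a)) (map (j ,_) (allFin n))

  split : degree (complete n) (i , a) ≡ cnt i a 0F ℕ.+ (cnt i a 1F ℕ.+ cnt i a 2F)
  split = trans (count-++ _ (map (0F ,_) (allFin n)) _) (cong (cnt i a 0F ℕ.+_)
         (trans (count-++ _ (map (1F ,_) (allFin n)) _) (cong (cnt i a 1F ℕ.+_)
         (trans (count-++ _ (map (2F ,_) (allFin n)) []) (ℕ.+-identityʳ _)))))

  full : ∀ i a j → (∀ b → adj (complete n) (i , a) (j , b) ≡ true) → n ℕ.≤ cnt i a j
  full i a j h = ℕ.≤-reflexive (sym (trans (count-true _ (j ,_) h (allFin n)) (List.length-tabulate (λ x → x))))

  bound : ∀ i a → n ℕ.+ n ℕ.≤ cnt i a 0F ℕ.+ (cnt i a 1F ℕ.+ cnt i a 2F)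
  bound 0F a = ℕ.≤-trans (ℕ.+-mono-≤ (full 0F a 1F λ _ → refl) (full 0F a 2F λ _ → refl))
                         (ℕ.m≤n+m _ (cnt 0F a 0F))
  bound 1F a = ℕ.+-mono-≤ (full 1F a 0F λ _ → refl)
                 (ℕ.≤-trans (full 1F a 2F λ _ → refl) (ℕ.m≤n+m _ (cnt 1F a 1F)))
  bound 2F a = ℕ.+-mono-≤ (full 2F a 0F λ _ → refl)
                 (ℕ.≤-trans (full 2F a 1F λ _ → refl) (ℕ.m≤m+n _ (cnt 2F a 2F)))

δ-complete : ∀ n → n ℕ.+ n ℕ.≤ δ (complete n)
δ-complete n = v≤min⁺ (ℕ.+-monoʳ-≤ n (ℕ.m≤m+n n _))
  (All.map⁺ (All.universal (degree-complete n) (vertices n)))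

f-attained : ∀ {n t} → t ℕ.≤ n → ∃ λ (G : 𝒢₃ n) → n ℕ.+ t ℕ.≤ δ G × τ G ≡ f n t
f-attained {n} {t} t≤n with argmin-sel (λ x → x) (τ (complete n)) (map τ (filter (λ G → n ℕ.+ t ℕ.≤? δ G) (allGraphs n)))
... | inj₁ eq = complete n , ℕ.≤-trans (ℕ.+-monoʳ-≤ n t≤n) (δ-complete n) , sym eq
... | inj₂ m∈ with ∈-map⁻ τ m∈
...   | G , G∈ , eq = G , proj₂ (∈-filter⁻ (λ G → n ℕ.+ t ℕ.≤? δ G) {xs = allGraphs n} G∈) , sym eq

-- The real numbers of the form a + b√5 with a and b rational, written ⟪ a , b ⟫.

infixl 6 _⊕_
infixl 7 _⊗_
infix  4 _≼_ _≼?_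

record ℚ√5 : Set where
  constructor ⟪_,_⟫
  field
    rational   : ℚ
    irrational : ℚ

ι : ℤ → ℚ√5
ι z = ⟪ z / 1 , 0ℚ ⟫

√5 1/√5 φ : ℚ√5
√5   = ⟪ 0ℚ , 1ℚ ⟫
1/√5 = ⟪ 0ℚ , + 1 / 5 ⟫
φ    = ⟪ ½ , ½ ⟫

_⊕_ _⊗_ : ℚ√5 → ℚ√5 → ℚ√5
⟪ a , b ⟫ ⊕ ⟪ c , d ⟫ = ⟪ a ℚ.+ c , b ℚ.+ d ⟫
⟪ a , b ⟫ ⊗ ⟪ c , d ⟫ = ⟪ a ℚ.* c ℚ.+ (+ 5 / 1) ℚ.* (b ℚ.* d) , a ℚ.* d ℚ.+ b ℚ.* c ⟫

⊝_ : ℚ√5 → ℚ√5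
⊝ ⟪ a , b ⟫ = ⟪ ℚ.- a , ℚ.- b ⟫

√5-square : √5 ⊗ √5 ≡ ι (+ 5)
√5-square = refl

√5-inverse : √5 ⊗ 1/√5 ≡ ι (+ 1)
√5-inverse = refl

φ-double : ι (+ 2) ⊗ φ ≡ ι (+ 1) ⊕ √5
φ-double = refl

-- The order inherited from the real numbers: a + b√5 ≥ 0 holds exactly if
-- both a, b ≥ 0, or a ≥ 0 and a² ≥ 5b², or b ≥ 0 and a² ≤ 5b².

NonNeg : ℚ√5 → Set
NonNeg ⟪ a , b ⟫ =
    (0ℚ ℚ.≤ a × 0ℚ ℚ.≤ b)
  ⊎ (0ℚ ℚ.≤ a × (+ 5 / 1) ℚ.* (b ℚ.* b) ℚ.≤ a ℚ.* a)
  ⊎ (0ℚ ℚ.≤ b × a ℚ.* a ℚ.≤ (+ 5 / 1) ℚ.* (b ℚ.* b))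

nonNeg? : ∀ x → Dec (NonNeg x)
nonNeg? ⟪ a , b ⟫ =
        ((0ℚ ℚ.≤? a) ×-dec (0ℚ ℚ.≤? b))
  ⊎-dec ((0ℚ ℚ.≤? a) ×-dec ((+ 5 / 1) ℚ.* (b ℚ.* b) ℚ.≤? a ℚ.* a))
  ⊎-dec ((0ℚ ℚ.≤? b) ×-dec (a ℚ.* a ℚ.≤? (+ 5 / 1) ℚ.* (b ℚ.* b)))

_≼_ : ℚ√5 → ℚ√5 → Set
x ≼ y = NonNeg (y ⊕ ⊝ x)

_≼?_ : ∀ x y → Dec (x ≼ y)
x ≼? y = nonNeg? (y ⊕ ⊝ x)

-- Floor by search: as √5 < 3, the integer `size x` is at least |x|, so the
-- largest integer below x is found by descending from size x to - size x.

size : ℚ√5 → ℕ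
size ⟪ a , b ⟫ = ℤ.∣ ℚ.↥ a ∣ ℕ.+ 3 ℕ.* ℤ.∣ ℚ.↥ b ∣

descend : ℚ√5 → ℤ → ℕ → ℤ
descend x z zero    = z
descend x z (suc k) with ι z ≼? x
... | yes _ = z
... | no  _ = descend x (ℤ.pred z) k

⌊_⌋ ⌈_⌉ : ℚ√5 → ℤ
⌊ x ⌋ = descend x (+ size x) (size x ℕ.+ size x)
⌈ x ⌉ = ℤ.- ⌊ ⊝ x ⌋

descend-spec : ∀ x z k → ¬ (ι (ℤ.suc z) ≼ x) → ι (z ℤ.- + k) ≼ x →
  let r = descend x z k in ι r ≼ x × ¬ (ι (ℤ.suc r) ≼ x)
descend-spec x z zero    above below = subst (λ y → ι y ≼ x) (ℤ.+-identityʳ z) below , above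
descend-spec x z (suc k) above below with ι z ≼? x
... | yes z≼x = z≼x , above
... | no  z⋠x = descend-spec x (ℤ.pred z) k
  (subst (λ y → ¬ (ι y ≼ x)) (sym (ℤ.suc-pred z)) z⋠x)
  (subst (λ y → ι y ≼ x) (shift z k) below)
  where
  shift : ∀ z k → z ℤ.- + suc k ≡ ℤ.pred z ℤ.- + k
  shift z k = trans (cong (λ w → z ℤ.+ w) (ℤ.neg-distrib-+ (+ 1) (+ k)))
    (trans (sym (ℤ.+-assoc z (-[1+ 0 ]) (ℤ.- + k))) (cong (ℤ._- + k) (ℤ.+-comm z -[1+ 0 ])))

/1-+ : ∀ m n → (m ℤ.+ n) / 1 ≡ m / 1 ℚ.+ n / 1
/1-+ m n = ℚ.toℚᵘ-injective (begin
  ℚ.toℚᵘ ((m ℤ.+ n) / 1)                 ≈⟨ ℚ.toℚᵘ-fromℚᵘ (ℚᵘ.mkℚᵘ (m ℤ.+ n) 0) ⟩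
  ℚᵘ.mkℚᵘ (m ℤ.+ n) 0                    ≈⟨ ℚᵘ.*≡* (cong (ℤ._* + 1) (sym (cong₂ ℤ._+_ (ℤ.*-identityʳ m) (ℤ.*-identityʳ n)))) ⟩
  ℚᵘ.mkℚᵘ m 0 ℚᵘ.+ ℚᵘ.mkℚᵘ n 0           ≈⟨ ℚᵘ.+-cong (ℚ.toℚᵘ-fromℚᵘ (ℚᵘ.mkℚᵘ m 0)) (ℚ.toℚᵘ-fromℚᵘ (ℚᵘ.mkℚᵘ n 0)) ⟨
  ℚ.toℚᵘ (m / 1) ℚᵘ.+ ℚ.toℚᵘ (n / 1)     ≈⟨ ℚ.toℚᵘ-homo-+ (m / 1) (n / 1) ⟨
  ℚ.toℚᵘ (m / 1 ℚ.+ n / 1)               ∎)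
  where open ℚᵘ.≃-Reasoning

/1-neg : ∀ m → (ℤ.- m) / 1 ≡ ℚ.- (m / 1)
/1-neg m = ℚ.toℚᵘ-injective (begin
  ℚ.toℚᵘ ((ℤ.- m) / 1)      ≈⟨ ℚ.toℚᵘ-fromℚᵘ (ℚᵘ.mkℚᵘ (ℤ.- m) 0) ⟩
  ℚᵘ.- ℚᵘ.mkℚᵘ m 0          ≈⟨ ℚᵘ.-‿cong (ℚ.toℚᵘ-fromℚᵘ (ℚᵘ.mkℚᵘ m 0)) ⟨
  ℚᵘ.- ℚ.toℚᵘ (m / 1)       ≈⟨ ℚ.toℚᵘ-homo‿- (m / 1) ⟨
  ℚ.toℚᵘ (ℚ.- (m / 1))      ∎)
  where open ℚᵘ.≃-Reasoning

triple : ℚ → ℚ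
triple p = p ℚ.+ (p ℚ.+ p)

0≤triple : ∀ {p} → 0ℚ ℚ.≤ p → 0ℚ ℚ.≤ triple p
0≤triple h = ℚ.+-mono-≤ h (ℚ.+-mono-≤ h h)

∣p∣²≡p² : ∀ p → ℚ.∣ p ∣ ℚ.* ℚ.∣ p ∣ ≡ p ℚ.* p
∣p∣²≡p² p with ℚ.∣p∣≡p∨∣p∣≡-p p
... | inj₁ eq = cong₂ ℚ._*_ eq eq
... | inj₂ eq = trans (cong₂ ℚ._*_ eq eq) (solve 1 (λ x → (:- x) :* (:- x) := x :* x) refl p)
  where open ℚ.+-*-Solver

p≤∣p∣ : ∀ p → p ℚ.≤ ℚ.∣ p ∣
p≤∣p∣ p with ℚ.≤-total 0ℚ p
... | inj₁ 0≤p = ℚ.≤-reflexive (sym (ℚ.0≤p⇒∣p∣≡p 0≤p))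
... | inj₂ p≤0 = ℚ.≤-trans p≤0 (ℚ.0≤∣p∣ p)

-p≤∣p∣ : ∀ p → ℚ.- p ℚ.≤ ℚ.∣ p ∣
-p≤∣p∣ p = subst (ℚ.- p ℚ.≤_) (ℚ.∣-p∣≡∣p∣ p) (p≤∣p∣ (ℚ.- p))

square-mono : ∀ {p q} → 0ℚ ℚ.≤ p → p ℚ.≤ q → p ℚ.* p ℚ.≤ q ℚ.* q
square-mono {p} {q} 0≤p p≤q = ℚ.≤-trans
  (ℚ.*-monoˡ-≤-nonNeg p {{ℚ.nonNegative 0≤p}} p≤q)
  (ℚ.*-monoʳ-≤-nonNeg q {{ℚ.nonNegative (ℚ.≤-trans 0≤p p≤q)}} p≤q)

square-mono-< : ∀ {p q} → 0ℚ ℚ.≤ p → p ℚ.< q → p ℚ.* p ℚ.< q ℚ.* q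
square-mono-< {p} {q} 0≤p p<q = ℚ.≤-<-trans
  (ℚ.*-monoˡ-≤-nonNeg p {{ℚ.nonNegative 0≤p}} (ℚ.<⇒≤ p<q))
  (ℚ.*-monoˡ-<-pos q {{ℚ.positive (ℚ.≤-<-trans 0≤p p<q)}} p<q)

5b²≤triple : ∀ b → (+ 5 / 1) ℚ.* (b ℚ.* b) ℚ.≤ triple ℚ.∣ b ∣ ℚ.* triple ℚ.∣ b ∣
5b²≤triple b = subst₂ ℚ._≤_
  (trans (ℚ.+-identityʳ _) (cong ((+ 5 / 1) ℚ.*_) (∣p∣²≡p² b)))
  (solve 1 (λ x → con (+ 5 / 1) :* (x :* x) :+ con (+ 4 / 1) :* (x :* x) := (x :+ (x :+ x)) :* (x :+ (x :+ x))) refl ∣b∣)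
  (ℚ.+-monoʳ-≤ ((+ 5 / 1) ℚ.* (∣b∣ ℚ.* ∣b∣))
    (ℚ.≤-trans (ℚ.≤-reflexive (sym (ℚ.*-zeroʳ (+ 4 / 1))))
      (ℚ.*-monoˡ-≤-nonNeg (+ 4 / 1) (square-mono (ℚ.≤-refl {0ℚ}) (ℚ.0≤∣p∣ b)))))
  where
  open ℚ.+-*-Solver
  ∣b∣ = ℚ.∣ b ∣

nonNeg-intro : ∀ c b → triple ℚ.∣ b ∣ ℚ.≤ c → NonNeg ⟪ c , b ⟫
nonNeg-intro c b h = inj₂ (inj₁ (ℚ.≤-trans 0≤3∣b∣ h , ℚ.≤-trans (5b²≤triple b) (square-mono 0≤3∣b∣ h)))
  where 0≤3∣b∣ = 0≤triple (ℚ.0≤∣p∣ b)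

nonNeg-elim : ∀ c b → NonNeg ⟪ c , b ⟫ → ℚ.- c ℚ.≤ triple ℚ.∣ b ∣
nonNeg-elim c b h with ℚ.≤-total 0ℚ c
... | inj₁ 0≤c = ℚ.≤-trans (ℚ.neg-antimono-≤ 0≤c) (0≤triple (ℚ.0≤∣p∣ b))
nonNeg-elim c b (inj₁ (0≤c , _))        | inj₂ _ = ℚ.≤-trans (ℚ.neg-antimono-≤ 0≤c) (0≤triple (ℚ.0≤∣p∣ b))
nonNeg-elim c b (inj₂ (inj₁ (0≤c , _))) | inj₂ _ = ℚ.≤-trans (ℚ.neg-antimono-≤ 0≤c) (0≤triple (ℚ.0≤∣p∣ b))
nonNeg-elim c b (inj₂ (inj₂ (_ , h)))   | inj₂ _ = ℚ.≮⇒≥ λ 3∣b∣<-c →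
  ℚ.<-irrefl refl (ℚ.<-≤-trans (square-mono-< (0≤triple (ℚ.0≤∣p∣ b)) 3∣b∣<-c)
    (ℚ.≤-trans (ℚ.≤-reflexive (solve 1 (λ x → (:- x) :* (:- x) := x :* x) refl c)) (ℚ.≤-trans h (5b²≤triple b))))
  where open ℚ.+-*-Solver

∣p∣≤numerator : ∀ p → ℚ.∣ p ∣ ℚ.≤ + ℤ.∣ ℚ.↥ p ∣ / 1
∣p∣≤numerator p@(ℚ.mkℚ n d c) = ℚ.toℚᵘ-cancel-≤ (ℚᵘ.≤-respʳ-≃
  (ℚᵘ.≃-sym (ℚ.toℚᵘ-fromℚᵘ (ℚᵘ.mkℚᵘ (+ ℤ.∣ n ∣) 0)))
  (ℚᵘ.*≤* (ℤ.*-monoˡ-≤-nonNeg (+ ℤ.∣ n ∣) (ℤ.+≤+ (ℕ.s≤s ℕ.z≤n)))))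

size-bound : ∀ a b → ℚ.∣ a ∣ ℚ.+ triple ℚ.∣ b ∣ ℚ.≤ + size ⟪ a , b ⟫ / 1
size-bound a b = subst (ℚ.∣ a ∣ ℚ.+ triple ℚ.∣ b ∣ ℚ.≤_) (sym split)
  (ℚ.+-mono-≤ (∣p∣≤numerator a) (ℚ.+-mono-≤ B (ℚ.+-mono-≤ B B)))
  where
  B = ∣p∣≤numerator b
  m = ℤ.∣ ℚ.↥ a ∣
  k = ℤ.∣ ℚ.↥ b ∣
  split : + (m ℕ.+ 3 ℕ.* k) / 1 ≡ + m / 1 ℚ.+ triple (+ k / 1)
  split = trans (/1-+ (+ m) (+ (3 ℕ.* k))) (cong (+ m / 1 ℚ.+_)
         (trans (/1-+ (+ k) (+ (2 ℕ.* k))) (cong (+ k / 1 ℚ.+_)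
         (trans (/1-+ (+ k) (+ (1 ℕ.* k))) (cong (λ j → + k / 1 ℚ.+ + j / 1) (ℕ.+-identityʳ k))))))

-size≼ : ∀ x → ι (ℤ.- + size x) ≼ x
-size≼ x@(⟪ a , b ⟫) = nonNeg-intro _ _ (subst₂ (λ b′ s → triple ℚ.∣ b′ ∣ ℚ.≤ a ℚ.- s)
  (sym (ℚ.+-identityʳ b)) (sym (/1-neg (+ size x))) (begin
    T                          ≡⟨ solve 2 (λ u v → v := (:- u) :+ (u :+ v)) refl ℚ.∣ a ∣ T ⟩
    ℚ.- ℚ.∣ a ∣ ℚ.+ (ℚ.∣ a ∣ ℚ.+ T)  ≤⟨ ℚ.+-mono-≤ a≥-∣a∣ (size-bound a b) ⟩
    a ℚ.+ M                    ≡⟨ solve 2 (λ u v → u :+ v := u :- (:- v)) refl a M ⟩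
    a ℚ.- ℚ.- M                ∎))
  where
  open ℚ.≤-Reasoning
  open ℚ.+-*-Solver
  T = triple ℚ.∣ b ∣
  M = + size x / 1
  a≥-∣a∣ : ℚ.- ℚ.∣ a ∣ ℚ.≤ a
  a≥-∣a∣ = subst (ℚ.- ℚ.∣ a ∣ ℚ.≤_) (solve 1 (λ u → :- (:- u) := u) refl a) (ℚ.neg-antimono-≤ (-p≤∣p∣ a))

size+1⋠ : ∀ x → ¬ (ι (ℤ.suc (+ size x)) ≼ x)
size+1⋠ x@(⟪ a , b ⟫) h = ℚ.<-irrefl refl (begin-strict
    T                                ≡⟨ ℚ.+-identityˡ T ⟨
    0ℚ ℚ.+ T                         <⟨ ℚ.+-monoˡ-< T 0<1 ⟩
    1ℚ ℚ.+ T                         ≡⟨ solve 2 (λ u v → con 1ℚ :+ v := con 1ℚ :+ (u :+ v) :- u) refl ℚ.∣ a ∣ T ⟩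
    1ℚ ℚ.+ (ℚ.∣ a ∣ ℚ.+ T) ℚ.- ℚ.∣ a ∣  ≤⟨ ℚ.+-mono-≤ (ℚ.+-monoʳ-≤ 1ℚ (size-bound a b)) (ℚ.neg-antimono-≤ (p≤∣p∣ a)) ⟩
    1ℚ ℚ.+ M ℚ.- a                   ≡⟨ solve 2 (λ u v → v :- u := :- (u :- v)) refl a (1ℚ ℚ.+ M) ⟩
    ℚ.- (a ℚ.- (1ℚ ℚ.+ M))           ≤⟨ elim ⟩
    T                                ∎)
  where
  open ℚ.≤-Reasoning
  open ℚ.+-*-Solver
  T = triple ℚ.∣ b ∣
  M = + size x / 1
  0<1 : 0ℚ ℚ.< 1ℚ
  0<1 = ℚ.positive⁻¹ 1ℚ
  elim : ℚ.- (a ℚ.- (1ℚ ℚ.+ M)) ℚ.≤ T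
  elim = subst₂ (λ b′ s → ℚ.- (a ℚ.- s) ℚ.≤ triple ℚ.∣ b′ ∣)
    (ℚ.+-identityʳ b) (/1-+ (+ 1) (+ size x)) (nonNeg-elim _ _ h)

⌊⌋-spec : ∀ x → ι ⌊ x ⌋ ≼ x × ¬ (ι (ℤ.suc ⌊ x ⌋) ≼ x)
⌊⌋-spec x = descend-spec x (+ size x) (size x ℕ.+ size x) (size+1⋠ x)
  (subst (λ y → ι y ≼ x) (sym eq) (-size≼ x))
  where
  eq : + size x ℤ.- + (size x ℕ.+ size x) ≡ ℤ.- + size x
  eq = trans (cong (λ w → + size x ℤ.+ w) (ℤ.neg-distrib-+ (+ size x) (+ size x)))
      (trans (sym (ℤ.+-assoc (+ size x) (ℤ.- + size x) (ℤ.- + size x)))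
      (trans (cong (ℤ._- + size x) (ℤ.+-inverseʳ (+ size x))) (ℤ.+-identityˡ _)))

⌈⌉-spec : ∀ x → x ≼ ι ⌈ x ⌉ × ¬ (x ≼ ι (ℤ.pred ⌈ x ⌉))
⌈⌉-spec x@(⟪ a , b ⟫) = subst NonNeg (flip z) (proj₁ (⌊⌋-spec (⊝ x))) ,
  λ h → proj₂ (⌊⌋-spec (⊝ x)) (subst NonNeg
    (trans (cong (λ w → ι w ⊕ ⊝ x) pred-neg) (sym (flip (ℤ.suc z)))) h)
  where
  z = ⌊ ⊝ x ⌋
  flip : ∀ z → ⊝ x ⊕ ⊝ ι z ≡ ι (ℤ.- z) ⊕ ⊝ x
  flip z = cong₂ ⟪_,_⟫ (trans (ℚ.+-comm (ℚ.- a) _) (cong (ℚ._- a) (sym (/1-neg z)))) (ℚ.+-comm (ℚ.- b) _)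
  pred-neg : ℤ.pred (ℤ.- z) ≡ ℤ.- ℤ.suc z
  pred-neg = sym (ℤ.neg-distrib-+ (+ 1) z)

{-# OPTIONS --safe #-}
module Submission where

-- Split parts 0 and 1 into blocks A, B, X with |A| = p + t and |B| = t, and
-- part 2 into A, B, X with |A| = |B| = p.  Edges can be placed such that the
-- triangles are exactly the edges between the A of one and the B of the other of
-- the parts 0 and 1, extended by any of the p vertices of one block of part 2,
-- and that the minimum degree is n + t as soon as the bipartite graph between A
-- and B gives every vertex of A degree at least 2t − p and every vertex of B
-- degree at least t.  A balanced such graph has max {t², (p + t)(2t − p)} edges.
--
-- The two terms of the maximum agree at p = φt.  With p = ⌊φt⌋ = t + u put
-- v = t² − u(u + t) ≥ 0.  If v > u, then ⌈φt⌉ is close enough to φt for the cost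
-- p t² of the ceiling to satisfy the second bound.  Otherwise ⌊φt⌋ is close
-- enough for the cost p (p + t)(2t − p) = p (t² + v) of the floor.

open import Defs
open import Algebra.Properties.CommutativeMonoid.Sum using (∑-distrib-+; ∑-comm)
import Algebra.Properties.Monoid.Sum as Sum
open import Algebra.Properties.Semiring.Sum using (*-distribʳ-sum)
open import Data.Bool using (Bool; true; false; _∧_; if_then_else_)
import Data.Bool.Properties as Bool
open import Data.Fin as Fin using (Fin; toℕ)
import Data.Fin.Properties as Fin
open import Data.Integer as ℤ using (ℤ; +_; -[1+_]; _+_; _-_; _*_; _^_; _≤_; _≥_; _⊔_; _⊓_)
import Data.Integer.Properties as ℤ
import Data.Integer.Tactic.RingSolver as ℤ-Solver
open import Data.List using (List; []; _∷_; _++_; map; allFin; tabulate)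
open import Data.List.Extrema.Nat using (v≤min⁺)
import Data.List.Properties as List
import Data.List.Relation.Unary.All as All
import Data.List.Relation.Unary.All.Properties as All
open import Data.Nat as ℕ using (ℕ; zero; suc; z≤n; s≤s; NonZero)
open import Data.Nat.Divisibility using (∣-refl)
open import Data.Nat.DivMod using (m<n⇒m/n≡0; m*n/n≡m; n/n≡1; /-monoˡ-≤; +-distrib-/-∣ʳ)
import Data.Nat.Properties as ℕ
open import Data.Nat.Tactic.RingSolver using (solve-∀)
open import Data.Product using (∃; _×_; _,_; proj₁; proj₂)
open import Data.Rational as ℚ using (ℚ; 0ℚ; 1ℚ; ½; _/_)
import Data.Rational.Properties as ℚ
import Data.Rational.Solver as ℚ-Solver
import Data.Rational.Unnormalised as ℚᵘ
import Data.Rational.Unnormalised.Properties as ℚᵘ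
open import Data.Sum using (_⊎_; inj₁; inj₂)
open import Data.Unit using (⊤; tt)
open import Function using (_∘_; flip)
open import Relation.Binary.PropositionalEquality
open import Relation.Nullary using (¬_; Dec; yes; no; contradiction)

-- Finite sums and balanced bipartite graphs

⟦_⟧ : Bool → ℕ
⟦ b ⟧ = if b then 1 else 0

open Sum ℕ.+-0-monoid using (sum-cong-≗) renaming (sum to ∑ᶠ)

∑ : ℕ → (ℕ → ℕ) → ℕ
∑ n g = ∑ᶠ {n} (g ∘ toℕ)

∑-cong : ∀ n {g h} → (∀ i → i ℕ.< n → g i ≡ h i) → ∑ n g ≡ ∑ n h
∑-cong n eq = sum-cong-≗ {n} λ i → eq (toℕ i) (Fin.toℕ<n i)

∑-split : ∀ m n g → ∑ (m ℕ.+ n) g ≡ ∑ m g ℕ.+ ∑ n (g ∘ (m ℕ.+_))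
∑-split zero    n g = refl
∑-split (suc m) n g = trans (cong (g 0 ℕ.+_) (∑-split m n (g ∘ suc))) (sym (ℕ.+-assoc (g 0) _ _))

∑-const : ∀ n c → ∑ n (λ _ → c) ≡ n ℕ.* c
∑-const zero    c = refl
∑-const (suc n) c = cong (c ℕ.+_) (∑-const n c)

∑-telescope : ∀ n (x y : ℕ → ℕ) → (∀ i → x i ℕ.+ y i ≡ y (suc i)) → ∑ n x ℕ.+ y 0 ≡ y n
∑-telescope zero    x y step = refl
∑-telescope (suc n) x y step = begin
  x 0 ℕ.+ ∑ n (x ∘ suc) ℕ.+ y 0    ≡⟨ lemma (x 0) _ (y 0) ⟩
  ∑ n (x ∘ suc) ℕ.+ (x 0 ℕ.+ y 0)  ≡⟨ cong (∑ n (x ∘ suc) ℕ.+_) (step 0) ⟩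
  ∑ n (x ∘ suc) ℕ.+ y 1            ≡⟨ ∑-telescope n (x ∘ suc) (y ∘ suc) (step ∘ suc) ⟩
  y (suc n)                        ∎
  where
  open ≡-Reasoning
  lemma : ∀ a b c → a ℕ.+ b ℕ.+ c ≡ b ℕ.+ (a ℕ.+ c)
  lemma = solve-∀

∑-shift : ∀ n (y : ℕ → ℕ) → ∑ n (y ∘ suc) ℕ.+ y 0 ≡ ∑ n y ℕ.+ y n
∑-shift zero    y = refl
∑-shift (suc n) y = begin
  y 1 ℕ.+ ∑ n (y ∘ suc ∘ suc) ℕ.+ y 0          ≡⟨ lemma (y 1) _ (y 0) ⟩
  y 0 ℕ.+ (∑ n (y ∘ suc ∘ suc) ℕ.+ y 1)        ≡⟨ cong (y 0 ℕ.+_) (∑-shift n (y ∘ suc)) ⟩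
  y 0 ℕ.+ (∑ n (y ∘ suc) ℕ.+ y (suc n))        ≡⟨ ℕ.+-assoc (y 0) _ _ ⟨
  y 0 ℕ.+ ∑ n (y ∘ suc) ℕ.+ y (suc n)          ∎
  where
  open ≡-Reasoning
  lemma : ∀ a b c → a ℕ.+ b ℕ.+ c ≡ c ℕ.+ (b ℕ.+ a)
  lemma = solve-∀

[m+n]/n≡1+m/n : ∀ m n .{{_ : NonZero n}} → (m ℕ.+ n) ℕ./ n ≡ suc (m ℕ./ n)
[m+n]/n≡1+m/n m n = trans (+-distrib-/-∣ʳ m ∣-refl)
  (trans (cong (m ℕ./ n ℕ.+_) (n/n≡1 n)) (ℕ.+-comm (m ℕ./ n) 1))

-- Hermite's identity at `m / b`. Raising `m` by one shifts the window of `b` quotients by one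
-- place, which replaces `m / b` by `(m + b) / b`, its successor.
hermite : ∀ b .{{_ : NonZero b}} m → ∑ b (λ j → (m ℕ.+ j) ℕ./ b) ≡ m
hermite b zero    = trans (∑-cong b (λ j j<b → m<n⇒m/n≡0 j<b)) (trans (∑-const b 0) (ℕ.*-zeroʳ b))
hermite b (suc m) = ℕ.+-cancelʳ-≡ (m ℕ./ b) _ _ (begin
  ∑ b (λ j → suc (m ℕ.+ j) ℕ./ b) ℕ.+ m ℕ./ b
    ≡⟨ cong₂ ℕ._+_ (∑-cong b (λ j _ → cong (ℕ._/ b) (sym (ℕ.+-suc m j)))) (cong (ℕ._/ b) (sym (ℕ.+-identityʳ m))) ⟩
  ∑ b (y ∘ suc) ℕ.+ y 0      ≡⟨ ∑-shift b y ⟩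
  ∑ b y ℕ.+ y b              ≡⟨ cong₂ ℕ._+_ (hermite b m) ([m+n]/n≡1+m/n m b) ⟩
  m ℕ.+ suc (m ℕ./ b)          ≡⟨ ℕ.+-suc m (m ℕ./ b) ⟩
  suc m ℕ.+ m ℕ./ b            ∎)
  where
  open ≡-Reasoning
  y : ℕ → ℕ
  y j = (m ℕ.+ j) ℕ./ b

-- When a sequence grows by at most one per step, the indicator of growth is the increment. Counting
-- edges thereby becomes telescoping.
⟦<ᵇ⟧ : ∀ {m n} → m ℕ.≤ n → n ℕ.≤ suc m → ⟦ m ℕ.<ᵇ n ⟧ ℕ.+ m ≡ n
⟦<ᵇ⟧ {zero}  {zero}        _         _               = refl
⟦<ᵇ⟧ {zero}  {suc zero}    _         _               = refl
⟦<ᵇ⟧ {zero}  {suc (suc n)} _         (s≤s ())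
⟦<ᵇ⟧ {suc m} {suc n}       (s≤s m≤n) (s≤s n≤1+m)     =
  trans (ℕ.+-suc ⟦ m ℕ.<ᵇ n ⟧ m) (cong suc (⟦<ᵇ⟧ m≤n n≤1+m))

-- Row i takes the r columns that follow, cyclically, those of row i ∸ 1; after
-- i rows column j has been taken ⌊(i r + j) / b⌋ times.

balanced : ∀ a b r s .{{_ : NonZero b}} → r ℕ.≤ b → s ℕ.* b ℕ.≤ a ℕ.* r →
  ∃ λ (E : ℕ → ℕ → Bool) →
    (∀ i → ∑ b (λ j → ⟦ E i j ⟧) ≡ r) ×
    (∀ j → j ℕ.< b → s ℕ.≤ ∑ a (λ i → ⟦ E i j ⟧))
balanced a b r s r≤b sb≤ar = E , row , col
  where
  taken : ℕ → ℕ → ℕ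
  taken i j = (i ℕ.* r ℕ.+ j) ℕ./ b

  E : ℕ → ℕ → Bool
  E i j = taken i j ℕ.<ᵇ taken (suc i) j

  step : ∀ i j → ⟦ E i j ⟧ ℕ.+ taken i j ≡ taken (suc i) j
  -- Here `r ≤ b` enters: the `r` cyclically consecutive columns of a row are distinct.
  step i j = ⟦<ᵇ⟧ (/-monoˡ-≤ b (ℕ.+-monoˡ-≤ j (ℕ.m≤n+m (i ℕ.* r) r))) (begin
    (r ℕ.+ i ℕ.* r ℕ.+ j) ℕ./ b     ≤⟨ /-monoˡ-≤ b (ℕ.+-monoˡ-≤ j (ℕ.+-monoˡ-≤ (i ℕ.* r) r≤b)) ⟩
    (b ℕ.+ i ℕ.* r ℕ.+ j) ℕ./ b     ≡⟨ cong (ℕ._/ b) (lemma b (i ℕ.* r) j) ⟩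
    (i ℕ.* r ℕ.+ j ℕ.+ b) ℕ./ b     ≡⟨ [m+n]/n≡1+m/n (i ℕ.* r ℕ.+ j) b ⟩
    suc (taken i j)               ∎)
    where
    open ℕ.≤-Reasoning
    lemma : ∀ x y z → x ℕ.+ y ℕ.+ z ≡ y ℕ.+ z ℕ.+ x
    lemma = solve-∀

  -- The degree is the difference of Hermite's identity at `suc i * r` and at `i * r`.
  row : ∀ i → ∑ b (λ j → ⟦ E i j ⟧) ≡ r
  row i = ℕ.+-cancelʳ-≡ (i ℕ.* r) _ _ (begin
    ∑ b (λ j → ⟦ E i j ⟧) ℕ.+ i ℕ.* r        ≡⟨ cong (∑ b (λ j → ⟦ E i j ⟧) ℕ.+_) (hermite b (i ℕ.* r)) ⟨
    ∑ b (λ j → ⟦ E i j ⟧) ℕ.+ ∑ b (taken i)  ≡⟨ ∑-distrib-+ ℕ.+-0-commutativeMonoid {b} (λ j → ⟦ E i (toℕ j) ⟧) (taken i ∘ toℕ) ⟨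
    ∑ b (λ j → ⟦ E i j ⟧ ℕ.+ taken i j)      ≡⟨ ∑-cong b (λ j _ → step i j) ⟩
    ∑ b (taken (suc i))                      ≡⟨ hermite b (suc i ℕ.* r) ⟩
    r ℕ.+ i ℕ.* r                            ∎)
    where open ≡-Reasoning

  -- The column sum telescopes from `j / b`, which is 0 as `j < b`, to `taken a j`; this is at least
  -- `s` because `s * b ≤ a * r`.
  col : ∀ j → j ℕ.< b → s ℕ.≤ ∑ a (λ i → ⟦ E i j ⟧)
  col j j<b = begin
    s                                    ≡⟨ m*n/n≡m s b ⟨
    s ℕ.* b ℕ./ b                          ≤⟨ /-monoˡ-≤ b (ℕ.≤-trans sb≤ar (ℕ.m≤m+n _ j)) ⟩
    taken a j                            ≡⟨ ∑-telescope a (λ i → ⟦ E i j ⟧) (λ i → taken i j) (λ i → step i j) ⟨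
    ∑ a (λ i → ⟦ E i j ⟧) ℕ.+ j ℕ./ b      ≡⟨ cong (∑ a (λ i → ⟦ E i j ⟧) ℕ.+_) (m<n⇒m/n≡0 j<b) ⟩
    ∑ a (λ i → ⟦ E i j ⟧) ℕ.+ 0          ≡⟨ ℕ.+-identityʳ _ ⟩
    ∑ a (λ i → ⟦ E i j ⟧)                ∎
    where open ℕ.≤-Reasoning

-- Degrees and triangles as sums over the parts

private variable
  S U : Set

count-∷ : (P : S → Bool) (x : S) (xs : List S) → count P (x ∷ xs) ≡ ⟦ P x ⟧ ℕ.+ count P xs
count-∷ P x xs with P x
... | true  = refl
... | false = refl

count-map : (P : U → Bool) (k : S → U) (xs : List S) → count P (map k xs) ≡ count (P ∘ k) xs
count-map P k []       = refl
count-map P k (x ∷ xs) with P (k x)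
... | true  = cong suc (count-map P k xs)
... | false = count-map P k xs

count-false : (P : S → Bool) → (∀ x → P x ≡ false) → ∀ xs → count P xs ≡ 0
count-false P h []       = refl
count-false P h (x ∷ xs) rewrite h x = count-false P h xs

count-tabulate : ∀ n (P : S → Bool) (k : Fin n → S) → count P (tabulate k) ≡ ∑ᶠ {n} (λ i → ⟦ P (k i) ⟧)
count-tabulate zero    P k = refl
count-tabulate (suc n) P k = trans (count-∷ P (k Fin.zero) _)
  (cong (⟦ P (k Fin.zero) ⟧ ℕ.+_) (count-tabulate n P (k ∘ Fin.suc)))

∑-zero : ∀ {n} {g : Fin n → ℕ} → (∀ i → g i ≡ 0) → ∑ᶠ g ≡ 0
∑-zero {zero}  h = refl
∑-zero {suc n} h = cong₂ ℕ._+_ (h Fin.zero) (∑-zero (h ∘ Fin.suc))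

-- Peels an independent part off the list: pairs inside it vanish, so the partner of each of its
-- vertices lies in `ys`.
count-pairs-++ : ∀ {n} (g : S × S → Bool) (k : Fin n → S) → (∀ a b → g (k a , k b) ≡ false) → ∀ ys →
  count g (pairs (tabulate k ++ ys)) ≡ ∑ᶠ (λ a → count (λ y → g (k a , y)) ys) ℕ.+ count g (pairs ys)
count-pairs-++ {n = zero}  g k h ys = refl
count-pairs-++ {n = suc n} g k h ys = begin
  count g (map (k₀ ,_) (tabulate k₊ ++ ys) ++ pairs (tabulate k₊ ++ ys))
    ≡⟨ count-++ g (map (k₀ ,_) (tabulate k₊ ++ ys)) _ ⟩
  count g (map (k₀ ,_) (tabulate k₊ ++ ys)) ℕ.+ count g (pairs (tabulate k₊ ++ ys))
    ≡⟨ cong₂ ℕ._+_ first (count-pairs-++ g k₊ (λ a b → h (Fin.suc a) (Fin.suc b)) ys) ⟩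
  count (g ∘ (k₀ ,_)) ys ℕ.+ (∑ᶠ (λ a → count (λ y → g (k₊ a , y)) ys) ℕ.+ count g (pairs ys))
    ≡⟨ ℕ.+-assoc (count (g ∘ (k₀ ,_)) ys) _ _ ⟨
  _ ∎
  where
  open ≡-Reasoning
  k₀ = k Fin.zero
  k₊ = k ∘ Fin.suc
  first : count g (map (k₀ ,_) (tabulate k₊ ++ ys)) ≡ count (g ∘ (k₀ ,_)) ys
  first = begin
    count g (map (k₀ ,_) (tabulate k₊ ++ ys))       ≡⟨ count-map g (k₀ ,_) (tabulate k₊ ++ ys) ⟩
    count (g ∘ (k₀ ,_)) (tabulate k₊ ++ ys)         ≡⟨ count-++ (g ∘ (k₀ ,_)) (tabulate k₊) ys ⟩
    count (g ∘ (k₀ ,_)) (tabulate k₊) ℕ.+ count (g ∘ (k₀ ,_)) ys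
      ≡⟨ cong (ℕ._+ count (g ∘ (k₀ ,_)) ys)
           (trans (count-tabulate n _ k₊) (∑-zero (λ b → cong ⟦_⟧ (h Fin.zero (Fin.suc b))))) ⟩
    count (g ∘ (k₀ ,_)) ys                          ∎

-- As the part stands first in the list, two vertices in it are the first two entries of a triple,
-- which the hypothesis on `g` rules out.
count-triples-++ : ∀ {n} (g : S × S × S → Bool) (k : Fin n → S) → (∀ a b z → g (k a , k b , z) ≡ false) → ∀ ys →
  count g (triples (tabulate k ++ ys)) ≡
  ∑ᶠ (λ a → count (λ yz → g (k a , yz)) (pairs ys)) ℕ.+ count g (triples ys)
count-triples-++ {n = zero}  g k h ys = refl
count-triples-++ {n = suc n} g k h ys = begin
  count g (map (k₀ ,_) (pairs (tabulate k₊ ++ ys)) ++ triples (tabulate k₊ ++ ys))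
    ≡⟨ count-++ g (map (k₀ ,_) (pairs (tabulate k₊ ++ ys))) _ ⟩
  count g (map (k₀ ,_) (pairs (tabulate k₊ ++ ys))) ℕ.+ count g (triples (tabulate k₊ ++ ys))
    ≡⟨ cong₂ ℕ._+_ first (count-triples-++ g k₊ (λ a b → h (Fin.suc a) (Fin.suc b)) ys) ⟩
  count (g ∘ (k₀ ,_)) (pairs ys) ℕ.+
    (∑ᶠ (λ a → count (λ yz → g (k₊ a , yz)) (pairs ys)) ℕ.+ count g (triples ys))
    ≡⟨ ℕ.+-assoc (count (g ∘ (k₀ ,_)) (pairs ys)) _ _ ⟨
  _ ∎
  where
  open ≡-Reasoning
  k₀ = k Fin.zero
  k₊ = k ∘ Fin.suc
  first : count g (map (k₀ ,_) (pairs (tabulate k₊ ++ ys))) ≡ count (g ∘ (k₀ ,_)) (pairs ys)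
  first = begin
    count g (map (k₀ ,_) (pairs (tabulate k₊ ++ ys)))  ≡⟨ count-map g (k₀ ,_) (pairs (tabulate k₊ ++ ys)) ⟩
    count (g ∘ (k₀ ,_)) (pairs (tabulate k₊ ++ ys))
      ≡⟨ count-pairs-++ (g ∘ (k₀ ,_)) k₊ (λ a b → h Fin.zero (Fin.suc a) (k₊ b)) ys ⟩
    ∑ᶠ (λ a → count (λ y → g (k₀ , k₊ a , y)) ys) ℕ.+ count (g ∘ (k₀ ,_)) (pairs ys)
      ≡⟨ cong (ℕ._+ count (g ∘ (k₀ ,_)) (pairs ys))
           (∑-zero (λ a → count-false _ (h Fin.zero (Fin.suc a)) ys)) ⟩
    count (g ∘ (k₀ ,_)) (pairs ys)                     ∎

module _ {n} (G : 𝒢₃ n) where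

  private
    part : Fin 3 → List (Vertex n)
    part i = tabulate (i ,_)

    vertices≡ : vertices n ≡ part 0F ++ part 1F ++ part 2F ++ []
    vertices≡ = cong₂ _++_ (eq 0F) (cong₂ _++_ (eq 1F) (cong (_++ []) (eq 2F)))
      where
      eq : ∀ (i : Fin 3) → map (i ,_) (allFin n) ≡ tabulate (i ,_)
      eq i = List.map-tabulate (λ a → a) (i ,_)

  degree-split : ∀ v → degree G v ≡
    ∑ᶠ (λ b → ⟦ adj G v (0F , b) ⟧) ℕ.+
    (∑ᶠ (λ b → ⟦ adj G v (1F , b) ⟧) ℕ.+ ∑ᶠ (λ b → ⟦ adj G v (2F , b) ⟧))
  degree-split v = trans (cong (count (adj G v)) vertices≡)
   (trans (count-++ (adj G v) (part 0F) _) (cong₂ ℕ._+_ (count-tabulate n _ _)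
   (trans (count-++ (adj G v) (part 1F) _) (cong₂ ℕ._+_ (count-tabulate n _ _)
   (trans (count-++ (adj G v) (part 2F) []) (trans (ℕ.+-identityʳ _) (count-tabulate n _ _)))))))

  τ-split : τ G ≡ ∑ᶠ λ a → ∑ᶠ λ b → ∑ᶠ λ c → ⟦ isTriangle G ((0F , a) , (1F , b) , (2F , c)) ⟧
  τ-split = begin
    count g (triples (vertices n))             ≡⟨ cong (count g ∘ triples) vertices≡ ⟩
    count g (triples (part 0F ++ V₁₂))         ≡⟨ count-triples-++ g (0F ,_) (loop 0F) V₁₂ ⟩
    ∑ᶠ (λ a → count (λ yz → g ((0F , a) , yz)) (pairs V₁₂)) ℕ.+ count g (triples V₁₂)
      -- A triple without a vertex in part 0 has two vertices in part 1 or two in part 2, so it is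
      -- no triangle.
      ≡⟨ cong₂ ℕ._+_ (sum-cong-≗ {n} through) (trans (count-triples-++ g (1F ,_) (loop 1F) V₂)
           (cong₂ ℕ._+_ (∑-zero (λ a → none (1F , a)))
           (trans (count-triples-++ g (2F ,_) (loop 2F) []) (cong (ℕ._+ 0) (∑-zero {n} (λ _ → refl)))))) ⟩
    _ ℕ.+ 0                                    ≡⟨ ℕ.+-identityʳ _ ⟩
    _                                          ∎
    where
    open ≡-Reasoning
    g = isTriangle G

    V₂ V₁₂ : List (Vertex n)
    V₂  = part 2F ++ []
    V₁₂ = part 1F ++ V₂

    loop : ∀ i a b z → g ((i , a) , (i , b) , z) ≡ false
    loop i a b z = cong (_∧ (adj G (i , a) z ∧ adj G (i , b) z)) (independent G i a b)

    loop′ : ∀ u i b c → g (u , (i , b) , (i , c)) ≡ false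
    loop′ u i b c = trans (cong (λ e → adj G u (i , b) ∧ adj G u (i , c) ∧ e) (independent G i b c))
      (trans (cong (adj G u (i , b) ∧_) (Bool.∧-zeroʳ _)) (Bool.∧-zeroʳ _))

    none : ∀ u → count (λ yz → g (u , yz)) (pairs V₂) ≡ 0
    none u = trans (count-pairs-++ _ (2F ,_) (loop′ u 2F) []) (cong (ℕ._+ 0) (∑-zero {n} (λ _ → refl)))

    through : ∀ a → count (λ yz → g ((0F , a) , yz)) (pairs V₁₂) ≡
                    ∑ᶠ λ b → ∑ᶠ λ c → ⟦ g ((0F , a) , (1F , b) , (2F , c)) ⟧
    through a = begin
      count (λ yz → g ((0F , a) , yz)) (pairs V₁₂)
        ≡⟨ count-pairs-++ _ (1F ,_) (loop′ (0F , a) 1F) V₂ ⟩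
      ∑ᶠ (λ b → count (λ z → g ((0F , a) , (1F , b) , z)) V₂) ℕ.+ count (λ yz → g ((0F , a) , yz)) (pairs V₂)
        ≡⟨ cong₂ ℕ._+_ (sum-cong-≗ {n} λ b →
             trans (cong (count _) (List.++-identityʳ (part 2F))) (count-tabulate n _ _)) (none (0F , a)) ⟩
      _ ℕ.+ 0   ≡⟨ ℕ.+-identityʳ _ ⟩
      _         ∎

-- The construction

-- The index of a vertex within `A` or `B` is kept because `E` depends on it; adjacency to `X`
-- depends on the block alone.
data Block : Set where
  A B : ℕ → Block
  X   : Block

block : ℕ → ℕ → ℕ → Block
block a b k with k ℕ.<? a | k ℕ.∸ a ℕ.<? b
... | yes _ | _     = A k
... | no  _ | yes _ = B (k ℕ.∸ a)
... | no  _ | no  _ = X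

InRange : ℕ → ℕ → Block → Set
InRange a b (A i) = i ℕ.< a
InRange a b (B j) = j ℕ.< b
InRange a b X     = ⊤

block-inRange : ∀ a b k → InRange a b (block a b k)
block-inRange a b k with k ℕ.<? a | k ℕ.∸ a ℕ.<? b
... | yes k<a | _       = k<a
... | no  _   | yes k<b = k<b
... | no  _   | no  _   = tt

block-A : ∀ a b k → k ℕ.< a → block a b k ≡ A k
block-A a b k k<a with k ℕ.<? a
... | yes _   = refl
... | no  k≮a = contradiction k<a k≮a

block-B : ∀ a b j → j ℕ.< b → block a b (a ℕ.+ j) ≡ B j
block-B a b j j<b with a ℕ.+ j ℕ.<? a | a ℕ.+ j ℕ.∸ a ℕ.<? b
... | yes q | _     = contradiction q (ℕ.m+n≮m a j)
... | no  _ | yes _ = cong B (ℕ.m+n∸m≡n a j)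
... | no  _ | no  q = contradiction (subst (ℕ._< b) (sym (ℕ.m+n∸m≡n a j)) j<b) q

block-X : ∀ a b l → block a b (a ℕ.+ (b ℕ.+ l)) ≡ X
block-X a b l with a ℕ.+ (b ℕ.+ l) ℕ.<? a | a ℕ.+ (b ℕ.+ l) ℕ.∸ a ℕ.<? b
... | yes q | _     = contradiction q (ℕ.m+n≮m a (b ℕ.+ l))
... | no  _ | yes q = contradiction (subst (ℕ._< b) (ℕ.m+n∸m≡n a (b ℕ.+ l)) q) (ℕ.m+n≮m b l)
... | no  _ | no  _ = refl

∑-block : ∀ a b x (F : Block → ℕ) →
  ∑ (a ℕ.+ (b ℕ.+ x)) (F ∘ block a b) ≡ ∑ a (F ∘ A) ℕ.+ (∑ b (F ∘ B) ℕ.+ x ℕ.* F X)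
∑-block a b x F =
  trans (∑-split a (b ℕ.+ x) (F ∘ block a b)) (cong₂ ℕ._+_ (∑-cong a (λ i i<a → cong F (block-A a b i i<a)))
 (trans (∑-split b x (F ∘ block a b ∘ (a ℕ.+_))) (cong₂ ℕ._+_ (∑-cong b (λ j j<b → cong F (block-B a b j j<b)))
 (trans (∑-cong x (λ l _ → cong F (block-X a b l))) (∑-const x (F X))))))

∑-*ʳ : ∀ n (g : ℕ → ℕ) c → ∑ n (λ i → g i ℕ.* c) ≡ ∑ n g ℕ.* c
∑-*ʳ n g c = sym (*-distribʳ-sum ℕ.+-*-semiring {n} c (g ∘ toℕ))

-- The symmetry that exchanges parts 0 and 1 must also exchange the two blocks of size `p` in part
-- 2.
swap : Block → Block
swap (A k) = B k
swap (B k) = A k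
swap X     = X

-- In parts 0 and 1 the blocks A and B have p + t and t vertices, in part 2 they
-- have p vertices each.  E joins block A of part 0 to block B of part 1 and,
-- transposed, block B of part 0 to block A of part 1.

module Construction (n t p x y : ℕ) (E : ℕ → ℕ → Bool)
  (n≡₁ : n ≡ p ℕ.+ t ℕ.+ (t ℕ.+ x)) (n≡₃ : n ≡ p ℕ.+ (p ℕ.+ y)) (p+t≤x : p ℕ.+ t ℕ.≤ x)
  (row : ∀ i → i ℕ.< p ℕ.+ t → t ℕ.+ t ℕ.≤ p ℕ.+ ∑ t (λ j → ⟦ E i j ⟧))
  (col : ∀ j → j ℕ.< t → t ℕ.≤ ∑ (p ℕ.+ t) (λ i → ⟦ E i j ⟧))
  where

  -- In part 2, the blocks `A`, `B`, `X` of part 0 see `A`, everything, and `A` with `X`; those of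
  -- part 1 see `B`, everything, and `B` with `X`. Hence the ends of an `A`-`A` or `A`-`X` edge have
  -- no common neighbour there, and only the edges from `E` lie in triangles.
  E₁₂ E₁₃ E₂₃ : Block → Block → Bool
  E₁₂ (A i) (A _) = true
  E₁₂ (A i) (B j) = E i j
  E₁₂ (A i) X     = true
  E₁₂ (B j) (A i) = E i j
  E₁₂ (B j) (B _) = false
  E₁₂ (B j) X     = false
  E₁₂ X     (A _) = true
  E₁₂ X     (B _) = false
  E₁₂ X     X     = false

  E₁₃ (A i) (A _) = true
  E₁₃ (A i) (B _) = false
  E₁₃ (A i) X     = false
  E₁₃ (B j) _     = true
  E₁₃ X     (A _) = true
  E₁₃ X     (B _) = false
  E₁₃ X     X     = true

  E₂₃ c e = E₁₃ c (swap e)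

  E₁₂-sym : ∀ c d → E₁₂ c d ≡ E₁₂ d c
  E₁₂-sym (A i) (A _) = refl
  E₁₂-sym (A i) (B j) = refl
  E₁₂-sym (A i) X     = refl
  E₁₂-sym (B j) (A i) = refl
  E₁₂-sym (B j) (B _) = refl
  E₁₂-sym (B j) X     = refl
  E₁₂-sym X     (A _) = refl
  E₁₂-sym X     (B _) = refl
  E₁₂-sym X     X     = refl

  block₁ block₃ : ℕ → Block
  block₁ = block (p ℕ.+ t) t
  block₃ = block p p

  G : 𝒢₃ n
  G = glue (λ a b → E₁₂ (block₁ (toℕ a)) (block₁ (toℕ b)))
           (λ a c → E₁₃ (block₁ (toℕ a)) (block₃ (toℕ c)))
           (λ b c → E₂₃ (block₁ (toℕ b)) (block₃ (toℕ c)))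

  ∑₁ : ∀ F → ∑ n (F ∘ block₁) ≡ ∑ (p ℕ.+ t) (F ∘ A) ℕ.+ (∑ t (F ∘ B) ℕ.+ x ℕ.* F X)
  ∑₁ F = subst (λ m → ∑ m (F ∘ block₁) ≡ _) (sym n≡₁) (∑-block (p ℕ.+ t) t x F)

  ∑₃ : ∀ F → ∑ n (F ∘ block₃) ≡ ∑ p (F ∘ A) ℕ.+ (∑ p (F ∘ B) ℕ.+ y ℕ.* F X)
  ∑₃ F = subst (λ m → ∑ m (F ∘ block₃) ≡ _) (sym n≡₃) (∑-block p p y F)

  ∑₁-const : ∀ α β F → (∀ i → F (A i) ≡ α) → (∀ j → F (B j) ≡ β) →
    ∑ n (F ∘ block₁) ≡ (p ℕ.+ t) ℕ.* α ℕ.+ (t ℕ.* β ℕ.+ x ℕ.* F X)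
  ∑₁-const α β F hA hB = trans (∑₁ F) (cong₂ ℕ._+_ (trans (∑-cong (p ℕ.+ t) λ i _ → hA i) (∑-const (p ℕ.+ t) α))
    (cong (ℕ._+ x ℕ.* F X) (trans (∑-cong t λ j _ → hB j) (∑-const t β))))

  ∑₃-const : ∀ α β F → (∀ i → F (A i) ≡ α) → (∀ j → F (B j) ≡ β) →
    ∑ n (F ∘ block₃) ≡ p ℕ.* α ℕ.+ (p ℕ.* β ℕ.+ y ℕ.* F X)
  ∑₃-const α β F hA hB = trans (∑₃ F) (cong₂ ℕ._+_ (trans (∑-cong p λ i _ → hA i) (∑-const p α))
    (cong (ℕ._+ y ℕ.* F X) (trans (∑-cong p λ j _ → hB j) (∑-const p β))))

  ∑₃-swap : ∀ F → ∑ n (F ∘ swap ∘ block₃) ≡ ∑ n (F ∘ block₃)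
  ∑₃-swap F = trans (∑₃ (F ∘ swap)) (trans (lemma (∑ p (F ∘ B)) (∑ p (F ∘ A)) (y ℕ.* F X)) (sym (∑₃ F)))
    where
    lemma : ∀ b a c → b ℕ.+ (a ℕ.+ c) ≡ a ℕ.+ (b ℕ.+ c)
    lemma = solve-∀

  -- Block `A` has `p` neighbours in part 2 and relies on `row`. Block `B` sees all of part 2 and
  -- needs `t` more from `col`. Block `X` attains `n + t` exactly.
  degree₁ : ∀ c → InRange (p ℕ.+ t) t c →
    n ℕ.+ t ℕ.≤ ∑ n (λ b → ⟦ E₁₂ c (block₁ b) ⟧) ℕ.+ ∑ n (λ k → ⟦ E₁₃ c (block₃ k) ⟧)
  degree₁ (A i) i<p+t = begin
    n ℕ.+ t                                          ≡⟨ cong (ℕ._+ t) n≡₁ ⟩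
    p ℕ.+ t ℕ.+ (t ℕ.+ x) ℕ.+ t                      ≡⟨ lemma₁ p t x ⟩
    t ℕ.+ t ℕ.+ (p ℕ.+ t ℕ.+ x)                      ≤⟨ ℕ.+-monoˡ-≤ (p ℕ.+ t ℕ.+ x) (row i i<p+t) ⟩
    p ℕ.+ R ℕ.+ (p ℕ.+ t ℕ.+ x)                      ≡⟨ lemma₂ p t x y R ⟩
    (p ℕ.+ t) ℕ.* 1 ℕ.+ (R ℕ.+ x ℕ.* 1) ℕ.+ (p ℕ.* 1 ℕ.+ (p ℕ.* 0 ℕ.+ y ℕ.* 0))
      ≡⟨ cong₂ ℕ._+_ (trans (∑₁ (λ d → ⟦ E₁₂ (A i) d ⟧)) (cong (ℕ._+ (R ℕ.+ x ℕ.* 1)) (∑-const (p ℕ.+ t) 1)))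
                     (∑₃-const 1 0 (λ e → ⟦ E₁₃ (A i) e ⟧) (λ _ → refl) (λ _ → refl)) ⟨
    _                                                ∎
    where
    open ℕ.≤-Reasoning
    R = ∑ t (λ j → ⟦ E i j ⟧)
    lemma₁ : ∀ p t x → p ℕ.+ t ℕ.+ (t ℕ.+ x) ℕ.+ t ≡ t ℕ.+ t ℕ.+ (p ℕ.+ t ℕ.+ x)
    lemma₁ = solve-∀
    lemma₂ : ∀ p t x y R → p ℕ.+ R ℕ.+ (p ℕ.+ t ℕ.+ x) ≡
      (p ℕ.+ t) ℕ.* 1 ℕ.+ (R ℕ.+ x ℕ.* 1) ℕ.+ (p ℕ.* 1 ℕ.+ (p ℕ.* 0 ℕ.+ y ℕ.* 0))
    lemma₂ = solve-∀
  degree₁ (B j) j<t = begin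
    n ℕ.+ t                                          ≡⟨ cong (ℕ._+ t) n≡₃ ⟩
    p ℕ.+ (p ℕ.+ y) ℕ.+ t                            ≤⟨ ℕ.+-monoʳ-≤ (p ℕ.+ (p ℕ.+ y)) (col j j<t) ⟩
    p ℕ.+ (p ℕ.+ y) ℕ.+ C                            ≡⟨ lemma p t x y C ⟩
    C ℕ.+ (t ℕ.* 0 ℕ.+ x ℕ.* 0) ℕ.+ (p ℕ.* 1 ℕ.+ (p ℕ.* 1 ℕ.+ y ℕ.* 1))
      ≡⟨ cong₂ ℕ._+_ (trans (∑₁ (λ d → ⟦ E₁₂ (B j) d ⟧)) (cong (λ z → C ℕ.+ (z ℕ.+ x ℕ.* 0)) (∑-const t 0)))
                     (∑₃-const 1 1 (λ e → ⟦ E₁₃ (B j) e ⟧) (λ _ → refl) (λ _ → refl)) ⟨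
    _                                                ∎
    where
    open ℕ.≤-Reasoning
    C = ∑ (p ℕ.+ t) (λ i → ⟦ E i j ⟧)
    lemma : ∀ p t x y C → p ℕ.+ (p ℕ.+ y) ℕ.+ C ≡
      C ℕ.+ (t ℕ.* 0 ℕ.+ x ℕ.* 0) ℕ.+ (p ℕ.* 1 ℕ.+ (p ℕ.* 1 ℕ.+ y ℕ.* 1))
    lemma = solve-∀
  degree₁ X _ = begin
    n ℕ.+ t                                          ≡⟨ cong (ℕ._+ t) n≡₃ ⟩
    p ℕ.+ (p ℕ.+ y) ℕ.+ t                            ≡⟨ lemma p t x y ⟩
    (p ℕ.+ t) ℕ.* 1 ℕ.+ (t ℕ.* 0 ℕ.+ x ℕ.* 0) ℕ.+ (p ℕ.* 1 ℕ.+ (p ℕ.* 0 ℕ.+ y ℕ.* 1))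
      ≡⟨ cong₂ ℕ._+_ (∑₁-const 1 0 (λ d → ⟦ E₁₂ X d ⟧) (λ _ → refl) (λ _ → refl))
                     (∑₃-const 1 0 (λ e → ⟦ E₁₃ X e ⟧) (λ _ → refl) (λ _ → refl)) ⟨
    _                                                ∎
    where
    open ℕ.≤-Reasoning
    lemma : ∀ p t x y → p ℕ.+ (p ℕ.+ y) ℕ.+ t ≡
      (p ℕ.+ t) ℕ.* 1 ℕ.+ (t ℕ.* 0 ℕ.+ x ℕ.* 0) ℕ.+ (p ℕ.* 1 ℕ.+ (p ℕ.* 0 ℕ.+ y ℕ.* 1))
    lemma = solve-∀

  -- Block `A` sees all of part 0 and the `t` vertices of `B` in part 1, exactly `n + t`; block `B`
  -- is its mirror image. Block `X` sees `t + x` vertices on either side, which is enough by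
  -- `p+t≤x`.
  degree₃ : ∀ e → n ℕ.+ t ℕ.≤ ∑ n (λ b → ⟦ E₁₃ (block₁ b) e ⟧) ℕ.+ ∑ n (λ b → ⟦ E₂₃ (block₁ b) e ⟧)
  degree₃ (A k) = begin
    n ℕ.+ t                                          ≡⟨ cong (ℕ._+ t) n≡₁ ⟩
    p ℕ.+ t ℕ.+ (t ℕ.+ x) ℕ.+ t                      ≡⟨ lemma p t x ⟩
    (p ℕ.+ t) ℕ.* 1 ℕ.+ (t ℕ.* 1 ℕ.+ x ℕ.* 1) ℕ.+ ((p ℕ.+ t) ℕ.* 0 ℕ.+ (t ℕ.* 1 ℕ.+ x ℕ.* 0))
      ≡⟨ cong₂ ℕ._+_ (∑₁-const 1 1 (λ c → ⟦ E₁₃ c (A k) ⟧) (λ _ → refl) (λ _ → refl))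
                     (∑₁-const 0 1 (λ c → ⟦ E₁₃ c (B k) ⟧) (λ _ → refl) (λ _ → refl)) ⟨
    _                                                ∎
    where
    open ℕ.≤-Reasoning
    lemma : ∀ p t x → p ℕ.+ t ℕ.+ (t ℕ.+ x) ℕ.+ t ≡
      (p ℕ.+ t) ℕ.* 1 ℕ.+ (t ℕ.* 1 ℕ.+ x ℕ.* 1) ℕ.+ ((p ℕ.+ t) ℕ.* 0 ℕ.+ (t ℕ.* 1 ℕ.+ x ℕ.* 0))
    lemma = solve-∀
  degree₃ (B k) = subst (n ℕ.+ t ℕ.≤_) (ℕ.+-comm (∑ n (λ b → ⟦ E₁₃ (block₁ b) (A k) ⟧)) _) (degree₃ (A k))
  degree₃ X = begin
    n ℕ.+ t                                          ≡⟨ cong (ℕ._+ t) n≡₁ ⟩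
    p ℕ.+ t ℕ.+ (t ℕ.+ x) ℕ.+ t                      ≤⟨ ℕ.+-monoˡ-≤ t (ℕ.+-monoˡ-≤ (t ℕ.+ x) p+t≤x) ⟩
    x ℕ.+ (t ℕ.+ x) ℕ.+ t                            ≡⟨ lemma p t x ⟩
    (p ℕ.+ t) ℕ.* 0 ℕ.+ (t ℕ.* 1 ℕ.+ x ℕ.* 1) ℕ.+ ((p ℕ.+ t) ℕ.* 0 ℕ.+ (t ℕ.* 1 ℕ.+ x ℕ.* 1))
      ≡⟨ cong₂ ℕ._+_ (∑₁-const 0 1 (λ c → ⟦ E₁₃ c X ⟧) (λ _ → refl) (λ _ → refl))
                     (∑₁-const 0 1 (λ c → ⟦ E₁₃ c X ⟧) (λ _ → refl) (λ _ → refl)) ⟨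
    _                                                ∎
    where
    open ℕ.≤-Reasoning
    lemma : ∀ p t x → x ℕ.+ (t ℕ.+ x) ℕ.+ t ≡
      (p ℕ.+ t) ℕ.* 0 ℕ.+ (t ℕ.* 1 ℕ.+ x ℕ.* 1) ℕ.+ ((p ℕ.+ t) ℕ.* 0 ℕ.+ (t ℕ.* 1 ℕ.+ x ℕ.* 1))
    lemma = solve-∀

  degree-bound : ∀ v → n ℕ.+ t ℕ.≤ degree G v
  degree-bound v = subst (n ℕ.+ t ℕ.≤_) (sym (degree-split G v)) (bound v)
    where
    bound : ∀ v → n ℕ.+ t ℕ.≤ ∑ᶠ (λ b → ⟦ adj G v (0F , b) ⟧) ℕ.+
      (∑ᶠ (λ b → ⟦ adj G v (1F , b) ⟧) ℕ.+ ∑ᶠ (λ b → ⟦ adj G v (2F , b) ⟧))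
    bound (0F , a) = ℕ.≤-trans (degree₁ (block₁ (toℕ a)) (block-inRange (p ℕ.+ t) t (toℕ a)))
      (ℕ.m≤n+m _ (∑ n (λ _ → 0)))
    -- Symmetry of `E₁₂` and the invariance of sums under `swap` reduce part 1 to part 0.
    bound (1F , a) = begin
      n ℕ.+ t  ≤⟨ degree₁ c (block-inRange (p ℕ.+ t) t (toℕ a)) ⟩
      ∑ n (λ b → ⟦ E₁₂ c (block₁ b) ⟧) ℕ.+ ∑ n (λ k → ⟦ E₁₃ c (block₃ k) ⟧)
        ≡⟨ cong₂ ℕ._+_ (∑-cong n (λ b _ → cong ⟦_⟧ (E₁₂-sym c (block₁ b)))) (sym (∑₃-swap (λ e → ⟦ E₁₃ c e ⟧))) ⟩
      ∑ n (λ b → ⟦ E₁₂ (block₁ b) c ⟧) ℕ.+ ∑ n (λ k → ⟦ E₂₃ c (block₃ k) ⟧)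
        ≤⟨ ℕ.+-monoʳ-≤ (∑ n (λ b → ⟦ E₁₂ (block₁ b) c ⟧)) (ℕ.m≤n+m _ _) ⟩
      _  ∎
      where
      open ℕ.≤-Reasoning
      c = block₁ (toℕ a)
    bound (2F , a) = ℕ.≤-trans (degree₃ (block₃ (toℕ a)))
      (ℕ.+-monoʳ-≤ (∑ n (λ b → ⟦ E₁₃ (block₁ b) (block₃ (toℕ a)) ⟧)) (ℕ.m≤m+n _ _))

  t≤n : t ℕ.≤ n
  t≤n = subst (t ℕ.≤_) (sym n≡₁) (ℕ.≤-trans (ℕ.m≤n+m t p) (ℕ.m≤m+n _ _))

  δ-bound : n ℕ.+ t ℕ.≤ δ G
  -- The default value `3n` of the minimum has to satisfy the bound as well, which follows from
  -- `t≤n`.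
  δ-bound = v≤min⁺ (ℕ.+-monoʳ-≤ n (ℕ.≤-trans t≤n (ℕ.m≤m+n n _)))
    (All.map⁺ (All.universal degree-bound (vertices n)))

  e : ℕ
  e = ∑ (p ℕ.+ t) (λ i → ∑ t (λ j → ⟦ E i j ⟧))

  weight : Block → Block → ℕ
  weight (A i) (B j) = ⟦ E i j ⟧ ℕ.* p
  weight (B j) (A i) = ⟦ E i j ⟧ ℕ.* p
  weight _     _     = 0

  -- The common neighbours of the ends of an edge from `E` are block `A` of part 2 if its `A`-end
  -- lies in part 0, and block `B` otherwise; both have `p` vertices.
  common : ∀ c d → ∑ n (λ k → ⟦ E₁₂ c d ∧ E₁₃ c (block₃ k) ∧ E₂₃ d (block₃ k) ⟧) ≡ weight c d
  common c d = trans (∑₃ (λ e → ⟦ E₁₂ c d ∧ E₁₃ c e ∧ E₂₃ d e ⟧)) (eval c d)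
    where
    F : Block → Block → Block → ℕ
    F c d e = ⟦ E₁₂ c d ∧ E₁₃ c e ∧ E₂₃ d e ⟧

    consts : ∀ α β γ → ∑ p (λ _ → α) ℕ.+ (∑ p (λ _ → β) ℕ.+ y ℕ.* γ) ≡ p ℕ.* α ℕ.+ (p ℕ.* β ℕ.+ y ℕ.* γ)
    consts α β γ = cong₂ (λ a b → a ℕ.+ (b ℕ.+ y ℕ.* γ)) (∑-const p α) (∑-const p β)

    none : ∑ p (λ _ → 0) ℕ.+ (∑ p (λ _ → 0) ℕ.+ y ℕ.* 0) ≡ 0
    none = trans (consts 0 0 0) (lemma p y)
      where
      lemma : ∀ p y → p ℕ.* 0 ℕ.+ (p ℕ.* 0 ℕ.+ y ℕ.* 0) ≡ 0
      lemma = solve-∀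

    eval : ∀ c d → ∑ p (F c d ∘ A) ℕ.+ (∑ p (F c d ∘ B) ℕ.+ y ℕ.* F c d X) ≡ weight c d
    eval (A i) (A _) = none
    eval (A i) (B j) with E i j
    ... | true  = trans (consts 1 0 0) (lemma p y)
      where
      lemma : ∀ p y → p ℕ.* 1 ℕ.+ (p ℕ.* 0 ℕ.+ y ℕ.* 0) ≡ 1 ℕ.* p
      lemma = solve-∀
    ... | false = none
    eval (A i) X     = none
    eval (B j) (A i) with E i j
    ... | true  = trans (consts 0 1 0) (lemma p y)
      where
      lemma : ∀ p y → p ℕ.* 0 ℕ.+ (p ℕ.* 1 ℕ.+ y ℕ.* 0) ≡ 1 ℕ.* p
      lemma = solve-∀
    ... | false = none
    eval (B j) (B _) = none
    eval (B j) X     = none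
    eval X     (A _) = none
    eval X     (B _) = none
    eval X     X     = none

  τ-value : τ G ≡ 2 ℕ.* (p ℕ.* e)
  τ-value = begin
    τ G                                                     ≡⟨ τ-split G ⟩
    ∑ n (λ a → ∑ n (λ b → ∑ n (λ k → ⟦ E₁₂ (block₁ a) (block₁ b) ∧ E₁₃ (block₁ a) (block₃ k) ∧ E₂₃ (block₁ b) (block₃ k) ⟧)))
      ≡⟨ ∑-cong n (λ a _ → ∑-cong n (λ b _ → common (block₁ a) (block₁ b))) ⟩
    ∑ n (λ a → W (block₁ a))                                ≡⟨ ∑₁ W ⟩
    ∑ (p ℕ.+ t) (W ∘ A) ℕ.+ (∑ t (W ∘ B) ℕ.+ x ℕ.* W X)
      ≡⟨ cong₂ ℕ._+_ (trans (∑-cong (p ℕ.+ t) (λ i _ → W-A i)) (∑-*ʳ (p ℕ.+ t) R p))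
           (cong₂ ℕ._+_ (trans (∑-cong t (λ j _ → W-B j)) (∑-*ʳ t C p)) (cong (x ℕ.*_) W-X)) ⟩
    e ℕ.* p ℕ.+ (∑ t (λ j → ∑ (p ℕ.+ t) (λ i → ⟦ E i j ⟧)) ℕ.* p ℕ.+ x ℕ.* 0)
      -- The edges at block `B` of part 0 are summed by columns; exchanging the sums gives `e`
      -- again, hence the factor 2.
      ≡⟨ cong (λ s → e ℕ.* p ℕ.+ (s ℕ.* p ℕ.+ x ℕ.* 0))
           (∑-comm ℕ.+-0-commutativeMonoid {p ℕ.+ t} {t} (λ i j → ⟦ E (toℕ i) (toℕ j) ⟧)) ⟨
    e ℕ.* p ℕ.+ (e ℕ.* p ℕ.+ x ℕ.* 0)                       ≡⟨ lemma e p x ⟩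
    2 ℕ.* (p ℕ.* e)                                         ∎
    where
    open ≡-Reasoning
    W : Block → ℕ
    W c = ∑ n (λ b → weight c (block₁ b))

    R C : ℕ → ℕ
    R i = ∑ t (λ j → ⟦ E i j ⟧)
    C j = ∑ (p ℕ.+ t) (λ i → ⟦ E i j ⟧)

    lemma : ∀ e p x → e ℕ.* p ℕ.+ (e ℕ.* p ℕ.+ x ℕ.* 0) ≡ 2 ℕ.* (p ℕ.* e)
    lemma = solve-∀

    zero-x : ∀ a → a ℕ.+ x ℕ.* 0 ≡ a
    zero-x a = trans (cong (a ℕ.+_) (ℕ.*-zeroʳ x)) (ℕ.+-identityʳ a)

    ∑-0 : ∀ m → ∑ m (λ _ → 0) ≡ 0
    ∑-0 m = trans (∑-const m 0) (ℕ.*-zeroʳ m)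

    W-A : ∀ i → W (A i) ≡ ∑ t (λ j → ⟦ E i j ⟧) ℕ.* p
    W-A i = trans (∑₁ (weight (A i))) (cong₂ ℕ._+_ (∑-0 (p ℕ.+ t)) (trans (zero-x _) (∑-*ʳ t (λ j → ⟦ E i j ⟧) p)))

    W-B : ∀ j → W (B j) ≡ ∑ (p ℕ.+ t) (λ i → ⟦ E i j ⟧) ℕ.* p
    W-B j = trans (∑₁ (weight (B j))) (trans (cong₂ ℕ._+_ (∑-*ʳ (p ℕ.+ t) (λ i → ⟦ E i j ⟧) p) (trans (zero-x _) (∑-0 t))) (ℕ.+-identityʳ _))

    W-X : W X ≡ 0
    W-X = trans (∑₁ (weight X)) (cong₂ ℕ._+_ (∑-0 (p ℕ.+ t)) (trans (zero-x _) (∑-0 t)))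

  f-bound : f n t ℕ.≤ 2 ℕ.* (p ℕ.* e)
  f-bound = subst (f n t ℕ.≤_) τ-value (f-minimal G δ-bound)

-- Arithmetic of the two costs

infix 9 _²
_² : ℕ → ℕ
x ² = x ℕ.* x

-- Since `t + u ≤ φt` means `u(u + t) ≤ t²`, positions relative to `φt` are compared through the
-- increasing function `x(x + t)`.
rising-cancel-< : ∀ t {x y} → x ℕ.* (x ℕ.+ t) ℕ.< y ℕ.* (y ℕ.+ t) → x ℕ.< y
rising-cancel-< t {x} {y} lt = ℕ.≰⇒> λ y≤x → ℕ.<⇒≱ lt (ℕ.*-mono-≤ y≤x (ℕ.+-monoˡ-≤ t y≤x))

-- Ensures `p = t + u ≤ 2t`, so that `2t − p` is a natural number, called `s` below.
rising-≤⇒≤ : ∀ t u → u ℕ.* (u ℕ.+ t) ℕ.≤ t ² → u ℕ.≤ t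
rising-≤⇒≤ t u h = ℕ.≮⇒≥ λ t<u → ℕ.<⇒≱ (ℕ.*-mono-< t<u t<u) (ℕ.≤-trans (ℕ.*-monoʳ-≤ u (ℕ.m≤m+n u t)) h)

-- With `p = t + u`, the product `(p + t)(2t − p)` exceeds `t²` by as much as `u(u + t)` falls short
-- of it. The maximum in the cost therefore changes its term at `p = φt`.
[p+t][2t∸p]+u[u+t]≡2t² : ∀ t u s → t ≡ u ℕ.+ s →
  (t ℕ.+ u ℕ.+ t) ℕ.* s ℕ.+ u ℕ.* (u ℕ.+ t) ≡ t ² ℕ.+ t ²
[p+t][2t∸p]+u[u+t]≡2t² _ u s refl = eq u s
  where
  eq : ∀ u s → (u ℕ.+ s ℕ.+ u ℕ.+ (u ℕ.+ s)) ℕ.* s ℕ.+ u ℕ.* (u ℕ.+ (u ℕ.+ s)) ≡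
    (u ℕ.+ s) ℕ.* (u ℕ.+ s) ℕ.+ (u ℕ.+ s) ℕ.* (u ℕ.+ s)
  eq = solve-∀

t²≤[p+t][2t∸p] : ∀ {t u s} → t ≡ u ℕ.+ s → u ℕ.* (u ℕ.+ t) ℕ.≤ t ² → t ² ℕ.≤ (t ℕ.+ u ℕ.+ t) ℕ.* s
t²≤[p+t][2t∸p] {t} {u} {s} t≡u+s h = ℕ.+-cancelʳ-≤ (t ²) _ _ (subst (ℕ._≤ (t ℕ.+ u ℕ.+ t) ℕ.* s ℕ.+ t ²)
  ([p+t][2t∸p]+u[u+t]≡2t² t u s t≡u+s) (ℕ.+-monoʳ-≤ ((t ℕ.+ u ℕ.+ t) ℕ.* s) h))

[p+t][2t∸p]≤t² : ∀ {t u s} → t ≡ u ℕ.+ s → t ² ℕ.≤ u ℕ.* (u ℕ.+ t) → (t ℕ.+ u ℕ.+ t) ℕ.* s ℕ.≤ t ²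
[p+t][2t∸p]≤t² {t} {u} {s} t≡u+s h = ℕ.+-cancelʳ-≤ (t ²) _ _ (subst ((t ℕ.+ u ℕ.+ t) ℕ.* s ℕ.+ t ² ℕ.≤_)
  ([p+t][2t∸p]+u[u+t]≡2t² t u s t≡u+s) (ℕ.+-monoʳ-≤ ((t ℕ.+ u ℕ.+ t) ℕ.* s) h))

-- b ≤ t³ + t² + (√5 t + 1/√5) t², as the square of √5 t + 1/√5 is (5t + 1)²/5.

Within : ℕ → ℕ → Set
Within t b = ∃ λ d → b ℕ.≤ t ℕ.* t ² ℕ.+ t ² ℕ.+ d × 5 ℕ.* d ² ℕ.≤ (t ² ℕ.* (5 ℕ.* t ℕ.+ 1)) ²

-- The ceiling is at most `t + u + 1`, so the part of its cost beyond `t³ + t²` is at most `t² r`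
-- with `r = t + 2u + 1`. Expanding `5r²` produces `20(u(u + t) + u)`, which `far` bounds by means
-- of `20t²`, and `5t² + 10t + 1 + 20t² = (5t + 1)²`.
ceiling-within : ∀ t u w → w ℕ.≤ suc u → suc (u ℕ.* (u ℕ.+ t) ℕ.+ u) ℕ.≤ t ² →
  Within t (2 ℕ.* ((t ℕ.+ w) ℕ.* t ²))
ceiling-within t u w w≤1+u far = t ² ℕ.* r , (begin
    2 ℕ.* ((t ℕ.+ w) ℕ.* t ²)         ≤⟨ ℕ.*-monoʳ-≤ 2 (ℕ.*-monoˡ-≤ (t ²) (ℕ.+-monoʳ-≤ t w≤1+u)) ⟩
    2 ℕ.* ((t ℕ.+ suc u) ℕ.* t ²)     ≡⟨ eq₁ t u ⟩
    t ℕ.* t ² ℕ.+ t ² ℕ.+ t ² ℕ.* r   ∎) , (begin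
    5 ℕ.* (t ² ℕ.* r) ²               ≡⟨ eq₂ (t ²) r ⟩
    (t ²) ² ℕ.* (5 ℕ.* r ²)           ≤⟨ ℕ.*-monoʳ-≤ ((t ²) ²) 5r²≤ ⟩
    (t ²) ² ℕ.* (5 ℕ.* t ℕ.+ 1) ²     ≡⟨ eq₃ (t ²) (5 ℕ.* t ℕ.+ 1) ⟩
    (t ² ℕ.* (5 ℕ.* t ℕ.+ 1)) ²       ∎)
  where
  open ℕ.≤-Reasoning
  r = t ℕ.+ 2 ℕ.* u ℕ.+ 1
  eq₁ : ∀ t u → 2 ℕ.* ((t ℕ.+ suc u) ℕ.* (t ℕ.* t)) ≡
    t ℕ.* (t ℕ.* t) ℕ.+ t ℕ.* t ℕ.+ t ℕ.* t ℕ.* (t ℕ.+ 2 ℕ.* u ℕ.+ 1)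
  eq₁ = solve-∀
  eq₂ : ∀ a r → 5 ℕ.* ((a ℕ.* r) ℕ.* (a ℕ.* r)) ≡ a ℕ.* a ℕ.* (5 ℕ.* (r ℕ.* r))
  eq₂ = solve-∀
  eq₃ : ∀ a r → a ℕ.* a ℕ.* (r ℕ.* r) ≡ (a ℕ.* r) ℕ.* (a ℕ.* r)
  eq₃ = solve-∀
  eq₄ : ∀ t u → 5 ℕ.* ((t ℕ.+ 2 ℕ.* u ℕ.+ 1) ℕ.* (t ℕ.+ 2 ℕ.* u ℕ.+ 1)) ℕ.+ 16 ≡
    5 ℕ.* (t ℕ.* t) ℕ.+ 10 ℕ.* t ℕ.+ 1 ℕ.+ 20 ℕ.* suc (u ℕ.* (u ℕ.+ t) ℕ.+ u)
  eq₄ = solve-∀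
  eq₅ : ∀ t → 5 ℕ.* (t ℕ.* t) ℕ.+ 10 ℕ.* t ℕ.+ 1 ℕ.+ 20 ℕ.* (t ℕ.* t) ≡ (5 ℕ.* t ℕ.+ 1) ℕ.* (5 ℕ.* t ℕ.+ 1)
  eq₅ = solve-∀
  5r²≤ : 5 ℕ.* r ² ℕ.≤ (5 ℕ.* t ℕ.+ 1) ²
  5r²≤ = begin
    5 ℕ.* r ²           ≤⟨ ℕ.m≤m+n _ 16 ⟩
    -- The 16 is the difference `1 + 20 − 5` of the constant terms.
    5 ℕ.* r ² ℕ.+ 16    ≡⟨ eq₄ t u ⟩
    5 ℕ.* t ² ℕ.+ 10 ℕ.* t ℕ.+ 1 ℕ.+ 20 ℕ.* suc (u ℕ.* (u ℕ.+ t) ℕ.+ u)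
      ≤⟨ ℕ.+-monoʳ-≤ (5 ℕ.* t ² ℕ.+ 10 ℕ.* t ℕ.+ 1) (ℕ.*-monoʳ-≤ 20 far) ⟩
    5 ℕ.* t ² ℕ.+ 10 ℕ.* t ℕ.+ 1 ℕ.+ 20 ℕ.* t ²  ≡⟨ eq₅ t ⟩
    (5 ℕ.* t ℕ.+ 1) ²   ∎

-- For `v = t² − u(u + t)`, the cost of the floor is `(t + u)(t² + v)`, and `near` says `v ≤ u`.
-- What remains is a polynomial inequality modulo the relation defining `v`. Writing `u = v + g` and
-- `t = t′ + 1` keeps its certificate within the natural numbers.
floor-within : ∀ t u s .{{_ : NonZero t}} → t ≡ u ℕ.+ s → u ℕ.* (u ℕ.+ t) ℕ.≤ t ² →
  t ² ℕ.≤ u ℕ.* (u ℕ.+ t) ℕ.+ u → Within t (2 ℕ.* ((t ℕ.+ u) ℕ.* ((t ℕ.+ u ℕ.+ t) ℕ.* s)))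
floor-within t@(suc t′) u s t≡u+s below near with ℕ.m≤n⇒∃[o]m+o≡n below
... | v , rel with ℕ.m≤n⇒∃[o]m+o≡n (ℕ.+-cancelˡ-≤ (u ℕ.* (u ℕ.+ t)) v u (subst (ℕ._≤ u ℕ.* (u ℕ.+ t) ℕ.+ u) (sym rel) near))
...   | g , refl = d , ℕ.≤-reflexive cost , square
  where
  open ℕ.≤-Reasoning
  d q W M : ℕ
  -- Chosen so that twice the cost is exactly `t³ + t² + d`; `t′` stands for `t − 1`.
  d = t ² ℕ.* (t′ ℕ.+ 2 ℕ.* u) ℕ.+ 2 ℕ.* ((t ℕ.+ u) ℕ.* v)
  q = t ℕ.+ 2 ℕ.* u
  W = t ² ℕ.* (5 ℕ.* t ℕ.+ 1)
  M = 20 ℕ.* ((t ² ℕ.+ v) ² ℕ.+ t ℕ.* t ²)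

  u≤t : u ℕ.≤ t
  u≤t = rising-≤⇒≤ t u below

  v≤t : v ℕ.≤ t
  v≤t = ℕ.≤-trans (ℕ.m≤m+n v g) u≤t

  width : (t ℕ.+ u ℕ.+ t) ℕ.* s ≡ t ² ℕ.+ v
  width = ℕ.+-cancelʳ-≡ (u ℕ.* (u ℕ.+ t)) _ _ (begin-equality
    (t ℕ.+ u ℕ.+ t) ℕ.* s ℕ.+ u ℕ.* (u ℕ.+ t)   ≡⟨ [p+t][2t∸p]+u[u+t]≡2t² t u s t≡u+s ⟩
    t ² ℕ.+ t ²                                 ≡⟨ cong (t ² ℕ.+_) rel ⟨
    t ² ℕ.+ (u ℕ.* (u ℕ.+ t) ℕ.+ v)             ≡⟨ eq (t ²) (u ℕ.* (u ℕ.+ t)) v ⟩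
    t ² ℕ.+ v ℕ.+ u ℕ.* (u ℕ.+ t)               ∎)
    where
    eq : ∀ a b v → a ℕ.+ (b ℕ.+ v) ≡ a ℕ.+ v ℕ.+ b
    eq = solve-∀

  cost : 2 ℕ.* ((t ℕ.+ u) ℕ.* ((t ℕ.+ u ℕ.+ t) ℕ.* s)) ≡ t ℕ.* t ² ℕ.+ t ² ℕ.+ d
  cost = trans (cong (λ x → 2 ℕ.* ((t ℕ.+ u) ℕ.* x)) width) (eq t′ u v)
    where
    eq : ∀ a u v → let t = suc a in 2 ℕ.* ((t ℕ.+ u) ℕ.* (t ℕ.* t ℕ.+ v)) ≡
      t ℕ.* (t ℕ.* t) ℕ.+ t ℕ.* t ℕ.+ (t ℕ.* t ℕ.* (a ℕ.+ 2 ℕ.* u) ℕ.+ 2 ℕ.* ((t ℕ.+ u) ℕ.* v))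
    eq = solve-∀

  -- Bounds `u` from below, in order to absorb the term `4t⁴` of `deficit`.
  t≤3u : t ℕ.≤ 3 ℕ.* u
  t≤3u = ℕ.*-cancelʳ-≤ t (3 ℕ.* u) t (begin
    t ²                               ≤⟨ near ⟩
    u ℕ.* (u ℕ.+ t) ℕ.+ u             ≤⟨ ℕ.+-mono-≤ (ℕ.*-monoʳ-≤ u (ℕ.+-monoˡ-≤ t u≤t)) (ℕ.m≤m*n u t) ⟩
    u ℕ.* (t ℕ.+ t) ℕ.+ u ℕ.* t       ≡⟨ eq t u ⟩
    3 ℕ.* u ℕ.* t                     ∎)
    where
    eq : ∀ t u → u ℕ.* (t ℕ.+ t) ℕ.+ u ℕ.* t ≡ 3 ℕ.* u ℕ.* t
    eq = solve-∀

  surplus deficit : ℕ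
  surplus = 10 ℕ.* (t ℕ.* t ²) ℕ.* (4 ℕ.* t ℕ.+ 2 ℕ.* u) ℕ.* g ℕ.+ 20 ℕ.* (t ℕ.* t ²) ℕ.* v
    ℕ.+ 10 ℕ.* (t ² ℕ.* v ²) ℕ.+ 20 ℕ.* (v ℕ.* v ²) ℕ.+ 10 ℕ.* (t ℕ.* q ℕ.* v) ℕ.* t ℕ.+ 10 ℕ.* (t ℕ.* t ² ℕ.* v)
  deficit = 4 ℕ.* (t ℕ.* t ²) ℕ.* t ℕ.+ 10 ℕ.* (t ℕ.* q ℕ.* v) ℕ.* v

  -- With t² = u(u + t) + v this says W² + deficit = 5d² + surplus; M is the
  -- cofactor of that relation.
  balance : W ² ℕ.+ M ℕ.* (u ℕ.* (u ℕ.+ t) ℕ.+ v) ℕ.+ deficit ≡ 5 ℕ.* d ² ℕ.+ M ℕ.* t ² ℕ.+ surplus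
  balance = eq t′ v g
    where
    eq : ∀ a v g → let t = suc a; u = v ℕ.+ g; q = t ℕ.+ 2 ℕ.* u
                       W = t ℕ.* t ℕ.* (5 ℕ.* t ℕ.+ 1)
                       d = t ℕ.* t ℕ.* (a ℕ.+ 2 ℕ.* u) ℕ.+ 2 ℕ.* ((t ℕ.+ u) ℕ.* v)
                       M = 20 ℕ.* ((t ℕ.* t ℕ.+ v) ℕ.* (t ℕ.* t ℕ.+ v) ℕ.+ t ℕ.* (t ℕ.* t)) in
      W ℕ.* W ℕ.+ M ℕ.* (u ℕ.* (u ℕ.+ t) ℕ.+ v)
        ℕ.+ (4 ℕ.* (t ℕ.* (t ℕ.* t)) ℕ.* t ℕ.+ 10 ℕ.* (t ℕ.* q ℕ.* v) ℕ.* v) ≡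
      5 ℕ.* (d ℕ.* d) ℕ.+ M ℕ.* (t ℕ.* t)
        ℕ.+ (10 ℕ.* (t ℕ.* (t ℕ.* t)) ℕ.* (4 ℕ.* t ℕ.+ 2 ℕ.* u) ℕ.* g ℕ.+ 20 ℕ.* (t ℕ.* (t ℕ.* t)) ℕ.* v
        ℕ.+ 10 ℕ.* (t ℕ.* t ℕ.* (v ℕ.* v)) ℕ.+ 20 ℕ.* (v ℕ.* (v ℕ.* v)) ℕ.+ 10 ℕ.* (t ℕ.* q ℕ.* v) ℕ.* t
        ℕ.+ 10 ℕ.* (t ℕ.* (t ℕ.* t) ℕ.* v))
    eq = solve-∀

  -- The term `4t⁴` is at most `12t³(v + g)`: its `v`-part fits into `20t³v`, its `g`-part into
  -- `10t³(4t + 2u)g` as `t ≥ 1`. The other term of `deficit` is covered by its counterpart in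
  -- `surplus` since `v ≤ t`.
  deficit≤surplus : deficit ℕ.≤ surplus
  deficit≤surplus = begin
    4 ℕ.* c ℕ.* t ℕ.+ z ℕ.* v
      ≤⟨ ℕ.+-mono-≤ (ℕ.*-monoʳ-≤ (4 ℕ.* c) t≤3u) (ℕ.*-monoʳ-≤ z v≤t) ⟩
    4 ℕ.* c ℕ.* (3 ℕ.* (v ℕ.+ g)) ℕ.+ z ℕ.* t
      ≤⟨ ℕ.m≤m+n _ _ ⟩
    4 ℕ.* c ℕ.* (3 ℕ.* (v ℕ.+ g)) ℕ.+ z ℕ.* t ℕ.+
      (8 ℕ.* c ℕ.* v ℕ.+ (28 ℕ.+ 40 ℕ.* t′ ℕ.+ 20 ℕ.* u) ℕ.* c ℕ.* g
       ℕ.+ 10 ℕ.* (t ² ℕ.* v ²) ℕ.+ 20 ℕ.* (v ℕ.* v ²) ℕ.+ 10 ℕ.* (c ℕ.* v))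
      ≡⟨ eq t′ u v g c (z ℕ.* t) (10 ℕ.* (t ² ℕ.* v ²)) (20 ℕ.* (v ℕ.* v ²)) ⟩
    surplus ∎
    where
    c z : ℕ
    c = t ℕ.* t ²
    z = 10 ℕ.* (t ℕ.* q ℕ.* v)
    eq : ∀ a u v g c z k l → 4 ℕ.* c ℕ.* (3 ℕ.* (v ℕ.+ g)) ℕ.+ z ℕ.+
      (8 ℕ.* c ℕ.* v ℕ.+ (28 ℕ.+ 40 ℕ.* a ℕ.+ 20 ℕ.* u) ℕ.* c ℕ.* g ℕ.+ k ℕ.+ l ℕ.+ 10 ℕ.* (c ℕ.* v)) ≡
      10 ℕ.* c ℕ.* (4 ℕ.* suc a ℕ.+ 2 ℕ.* u) ℕ.* g ℕ.+ 20 ℕ.* c ℕ.* v ℕ.+ k ℕ.+ l ℕ.+ z ℕ.+ 10 ℕ.* (c ℕ.* v)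
    eq = solve-∀

  square : 5 ℕ.* d ² ℕ.≤ W ²
  square = ℕ.+-cancelʳ-≤ (M ℕ.* t ² ℕ.+ surplus) _ _ (begin
    5 ℕ.* d ² ℕ.+ (M ℕ.* t ² ℕ.+ surplus)               ≡⟨ ℕ.+-assoc (5 ℕ.* d ²) _ _ ⟨
    5 ℕ.* d ² ℕ.+ M ℕ.* t ² ℕ.+ surplus                 ≡⟨ balance ⟨
    W ² ℕ.+ M ℕ.* (u ℕ.* (u ℕ.+ t) ℕ.+ v) ℕ.+ deficit   ≡⟨ cong (λ x → W ² ℕ.+ M ℕ.* x ℕ.+ deficit) rel ⟩
    W ² ℕ.+ M ℕ.* t ² ℕ.+ deficit                       ≤⟨ ℕ.+-monoʳ-≤ (W ² ℕ.+ M ℕ.* t ²) deficit≤surplus ⟩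
    W ² ℕ.+ M ℕ.* t ² ℕ.+ surplus                       ≡⟨ ℕ.+-assoc (W ²) _ _ ⟩
    W ² ℕ.+ (M ℕ.* t ² ℕ.+ surplus)                     ∎)

-- Comparisons in ℚ√5 reduced to the integers

/1-* : ∀ m n → (m ℤ.* n) / 1 ≡ (m / 1) ℚ.* (n / 1)
/1-* m n = ℚ.toℚᵘ-injective (begin
  ℚ.toℚᵘ ((m ℤ.* n) / 1)                 ≈⟨ ℚ.toℚᵘ-fromℚᵘ (ℚᵘ.mkℚᵘ (m ℤ.* n) 0) ⟩
  ℚᵘ.mkℚᵘ m 0 ℚᵘ.* ℚᵘ.mkℚᵘ n 0           ≈⟨ ℚᵘ.*-cong (ℚ.toℚᵘ-fromℚᵘ (ℚᵘ.mkℚᵘ m 0)) (ℚ.toℚᵘ-fromℚᵘ (ℚᵘ.mkℚᵘ n 0)) ⟨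
  ℚ.toℚᵘ (m / 1) ℚᵘ.* ℚ.toℚᵘ (n / 1)     ≈⟨ ℚ.toℚᵘ-homo-* (m / 1) (n / 1) ⟨
  ℚ.toℚᵘ ((m / 1) ℚ.* (n / 1))           ∎)
  where open ℚᵘ.≃-Reasoning

/1-mono-≤ : ∀ {m n} → m ℤ.≤ n → m / 1 ℚ.≤ n / 1
/1-mono-≤ {m} {n} m≤n = ℚ.toℚᵘ-cancel-≤ (begin
  ℚ.toℚᵘ (m / 1)   ≃⟨ ℚ.toℚᵘ-fromℚᵘ (ℚᵘ.mkℚᵘ m 0) ⟩
  ℚᵘ.mkℚᵘ m 0      ≤⟨ ℚᵘ.*≤* (ℤ.*-monoʳ-≤-nonNeg (+ 1) m≤n) ⟩
  ℚᵘ.mkℚᵘ n 0      ≃⟨ ℚ.toℚᵘ-fromℚᵘ (ℚᵘ.mkℚᵘ n 0) ⟨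
  ℚ.toℚᵘ (n / 1)   ∎)
  where open ℚᵘ.≤-Reasoning

/1-cancel-≤ : ∀ {m n} → m / 1 ℚ.≤ n / 1 → m ℤ.≤ n
/1-cancel-≤ {m} {n} h = ℤ.*-cancelʳ-≤-pos m n (+ 1) (ℚᵘ.drop-*≤* (begin
  ℚᵘ.mkℚᵘ m 0      ≃⟨ ℚ.toℚᵘ-fromℚᵘ (ℚᵘ.mkℚᵘ m 0) ⟨
  ℚ.toℚᵘ (m / 1)   ≤⟨ ℚ.toℚᵘ-mono-≤ h ⟩
  ℚ.toℚᵘ (n / 1)   ≃⟨ ℚ.toℚᵘ-fromℚᵘ (ℚᵘ.mkℚᵘ n 0) ⟩
  ℚᵘ.mkℚᵘ n 0      ∎))
  where open ℚᵘ.≤-Reasoning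

i*i≡+∣i∣² : ∀ i → i ℤ.* i ≡ + ℤ.∣ i ∣ ²
i*i≡+∣i∣² (+ n)      = sym (ℤ.pos-* n n)
i*i≡+∣i∣² (-[1+ n ]) = refl

NonNegℤ : ℤ → ℤ → Set
NonNegℤ a b =
    (+ 0 ℤ.≤ a × + 0 ℤ.≤ b)
  ⊎ (+ 0 ℤ.≤ a × 5 ℕ.* ℤ.∣ b ∣ ² ℕ.≤ ℤ.∣ a ∣ ²)
  ⊎ (+ 0 ℤ.≤ b × ℤ.∣ a ∣ ² ℕ.≤ 5 ℕ.* ℤ.∣ b ∣ ²)

module _ (c : ℚ) .{{_ : ℚ.Positive c}} where

  private
    scale-mono : ∀ d .{{_ : ℚ.Positive d}} {m n} → m ℤ.≤ n → d ℚ.* (m / 1) ℚ.≤ d ℚ.* (n / 1)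
    scale-mono d m≤n = ℚ.*-monoˡ-≤-nonNeg d {{ℚ.pos⇒nonNeg d}} (/1-mono-≤ m≤n)

    scale-cancel : ∀ d .{{_ : ℚ.Positive d}} {m n} → d ℚ.* (m / 1) ℚ.≤ d ℚ.* (n / 1) → m ℤ.≤ n
    scale-cancel d h = /1-cancel-≤ (ℚ.*-cancelˡ-≤-pos d h)

    instance
      c²-pos : ℚ.Positive (c ℚ.* c)
      c²-pos = ℚ.pos*pos⇒pos c c

    scale-0 : 0ℚ ≡ c ℚ.* (+ 0 / 1)
    scale-0 = sym (ℚ.*-zeroʳ c)

    scale-² : ∀ a → (c ℚ.* (a / 1)) ℚ.* (c ℚ.* (a / 1)) ≡ (c ℚ.* c) ℚ.* (+ ℤ.∣ a ∣ ² / 1)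
    scale-² a = trans (solve 2 (λ x y → (x :* y) :* (x :* y) := (x :* x) :* (y :* y)) refl c (a / 1))
      (cong ((c ℚ.* c) ℚ.*_) (trans (sym (/1-* a a)) (cong (_/ 1) (i*i≡+∣i∣² a))))
      where open ℚ-Solver.+-*-Solver

    scale-5² : ∀ b → (+ 5 / 1) ℚ.* ((c ℚ.* (b / 1)) ℚ.* (c ℚ.* (b / 1))) ≡
                     (c ℚ.* c) ℚ.* (+ (5 ℕ.* ℤ.∣ b ∣ ²) / 1)
    scale-5² b = trans (cong ((+ 5 / 1) ℚ.*_) (scale-² b))
      (trans (solve 3 (λ x y z → x :* (y :* z) := y :* (x :* z)) refl (+ 5 / 1) (c ℚ.* c) (+ ℤ.∣ b ∣ ² / 1))
      (cong ((c ℚ.* c) ℚ.*_) (trans (sym (/1-* (+ 5) (+ ℤ.∣ b ∣ ²))) (cong (_/ 1) (sym (ℤ.pos-* 5 (ℤ.∣ b ∣ ²)))))))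
      where open ℚ-Solver.+-*-Solver

    0≤⁺ : ∀ {a} → + 0 ℤ.≤ a → 0ℚ ℚ.≤ c ℚ.* (a / 1)
    0≤⁺ {a} h = subst (ℚ._≤ c ℚ.* (a / 1)) (sym scale-0) (scale-mono c h)

    0≤⁻ : ∀ {a} → 0ℚ ℚ.≤ c ℚ.* (a / 1) → + 0 ℤ.≤ a
    0≤⁻ {a} h = scale-cancel c (subst (ℚ._≤ c ℚ.* (a / 1)) scale-0 h)

  -- A positive factor does not affect the sign of `a + b√5`. It serves to clear denominators, with
  -- `c = ½` for `φ` and `c = 1/5` for `1/√5`.
  nonNeg-scale⁺ : ∀ a b → NonNegℤ a b → NonNeg ⟪ c ℚ.* (a / 1) , c ℚ.* (b / 1) ⟫
  nonNeg-scale⁺ a b (inj₁ (0≤a , 0≤b))      = inj₁ (0≤⁺ 0≤a , 0≤⁺ 0≤b)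
  nonNeg-scale⁺ a b (inj₂ (inj₁ (0≤a , h))) = inj₂ (inj₁ (0≤⁺ 0≤a ,
    subst₂ ℚ._≤_ (sym (scale-5² b)) (sym (scale-² a)) (scale-mono (c ℚ.* c) (ℤ.+≤+ h))))
  nonNeg-scale⁺ a b (inj₂ (inj₂ (0≤b , h))) = inj₂ (inj₂ (0≤⁺ 0≤b ,
    subst₂ ℚ._≤_ (sym (scale-² a)) (sym (scale-5² b)) (scale-mono (c ℚ.* c) (ℤ.+≤+ h))))

  nonNeg-scale⁻ : ∀ a b → NonNeg ⟪ c ℚ.* (a / 1) , c ℚ.* (b / 1) ⟫ → NonNegℤ a b
  nonNeg-scale⁻ a b (inj₁ (0≤a , 0≤b))      = inj₁ (0≤⁻ 0≤a , 0≤⁻ 0≤b)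
  nonNeg-scale⁻ a b (inj₂ (inj₁ (0≤a , h))) = inj₂ (inj₁ (0≤⁻ 0≤a ,
    ℤ.drop‿+≤+ (scale-cancel (c ℚ.* c) (subst₂ ℚ._≤_ (scale-5² b) (scale-² a) h))))
  nonNeg-scale⁻ a b (inj₂ (inj₂ (0≤b , h))) = inj₂ (inj₂ (0≤⁻ 0≤b ,
    ℤ.drop‿+≤+ (scale-cancel (c ℚ.* c) (subst₂ ℚ._≤_ (scale-² a) (scale-5² b) h))))

φ-minus : ∀ i z → φ ⊗ ι i ⊕ ⊝ ι z ≡ ⟪ ½ ℚ.* ((i ℤ.- (z ℤ.+ z)) / 1) , ½ ℚ.* (i / 1) ⟫
φ-minus i z = cong₂ ⟪_,_⟫
  (trans (solve 2 (λ x y → con ½ :* x :+ con (+ 5 / 1) :* (con ½ :* con 0ℚ) :+ (:- y) := con ½ :* (x :+ :- (y :+ y)))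
                refl (i / 1) (z / 1))
         (cong (½ ℚ.*_) (sym (trans (/1-+ i (ℤ.- (z ℤ.+ z)))
           (cong (i / 1 ℚ.+_) (trans (/1-neg (z ℤ.+ z)) (cong ℚ.-_ (/1-+ z z))))))))
  (solve 1 (λ x → con ½ :* con 0ℚ :+ con ½ :* x :+ (:- con 0ℚ) := con ½ :* x) refl (i / 1))
  where open ℚ-Solver.+-*-Solver

minus-φ : ∀ i z → ι z ⊕ ⊝ (φ ⊗ ι i) ≡ ⟪ ½ ℚ.* (((z ℤ.+ z) ℤ.- i) / 1) , ½ ℚ.* ((ℤ.- i) / 1) ⟫
minus-φ i z = cong₂ ⟪_,_⟫
  (trans (solve 2 (λ x y → y :+ (:- (con ½ :* x :+ con (+ 5 / 1) :* (con ½ :* con 0ℚ))) := con ½ :* ((y :+ y) :+ :- x))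
                refl (i / 1) (z / 1))
         (cong (½ ℚ.*_) (sym (trans (/1-+ (z ℤ.+ z) (ℤ.- i)) (cong₂ ℚ._+_ (/1-+ z z) (/1-neg i))))))
  (trans (solve 1 (λ x → con 0ℚ :+ (:- (con ½ :* con 0ℚ :+ con ½ :* x)) := con ½ :* (:- x)) refl (i / 1))
         (cong (½ ℚ.*_) (sym (/1-neg i))))
  where open ℚ-Solver.+-*-Solver

≼φ⁺ : ∀ i z → NonNegℤ (i ℤ.- (z ℤ.+ z)) i → ι z ≼ φ ⊗ ι i
≼φ⁺ i z h = subst NonNeg (sym (φ-minus i z)) (nonNeg-scale⁺ ½ (i ℤ.- (z ℤ.+ z)) i h)

≼φ⁻ : ∀ i z → ι z ≼ φ ⊗ ι i → NonNegℤ (i ℤ.- (z ℤ.+ z)) i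
≼φ⁻ i z h = nonNeg-scale⁻ ½ (i ℤ.- (z ℤ.+ z)) i (subst NonNeg (φ-minus i z) h)

φ≼⁺ : ∀ i z → NonNegℤ ((z ℤ.+ z) ℤ.- i) (ℤ.- i) → φ ⊗ ι i ≼ ι z
φ≼⁺ i z h = subst NonNeg (sym (minus-φ i z)) (nonNeg-scale⁺ ½ ((z ℤ.+ z) ℤ.- i) (ℤ.- i) h)

φ≼⁻ : ∀ i z → φ ⊗ ι i ≼ ι z → NonNegℤ ((z ℤ.+ z) ℤ.- i) (ℤ.- i)
φ≼⁻ i z h = nonNeg-scale⁻ ½ ((z ℤ.+ z) ℤ.- i) (ℤ.- i) (subst NonNeg (minus-φ i z) h)

-- Comparing z = t + u with φt amounts to comparing (2z − t)² = t² + 4u(u + t)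
-- with (√5 t)² = 5t².

module _ (t : ℕ) .{{_ : NonZero t}} where
  private
    T : ℤ
    T = + t

    complete-square : ∀ t u → (t ℕ.+ (u ℕ.+ u)) ℕ.* (t ℕ.+ (u ℕ.+ u)) ≡ t ℕ.* t ℕ.+ 4 ℕ.* (u ℕ.* (u ℕ.+ t))
    complete-square = solve-∀

    ²≤5²⁺ : ∀ u → u ℕ.* (u ℕ.+ t) ℕ.≤ t ² → (t ℕ.+ (u ℕ.+ u)) ² ℕ.≤ 5 ℕ.* t ²
    ²≤5²⁺ u h = subst (ℕ._≤ 5 ℕ.* t ²) (sym (complete-square t u)) (ℕ.+-monoʳ-≤ (t ²) (ℕ.*-monoʳ-≤ 4 h))

    ²≤5²⁻ : ∀ u → (t ℕ.+ (u ℕ.+ u)) ² ℕ.≤ 5 ℕ.* t ² → u ℕ.* (u ℕ.+ t) ℕ.≤ t ²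
    ²≤5²⁻ u h = ℕ.*-cancelˡ-≤ 4 (ℕ.+-cancelˡ-≤ (t ²) _ _ (subst (ℕ._≤ 5 ℕ.* t ²) (complete-square t u) h))

    5²≤²⁺ : ∀ u → t ² ℕ.≤ u ℕ.* (u ℕ.+ t) → 5 ℕ.* t ² ℕ.≤ (t ℕ.+ (u ℕ.+ u)) ²
    5²≤²⁺ u h = subst (5 ℕ.* t ² ℕ.≤_) (sym (complete-square t u)) (ℕ.+-monoʳ-≤ (t ²) (ℕ.*-monoʳ-≤ 4 h))

    5²≤²⁻ : ∀ u → 5 ℕ.* t ² ℕ.≤ (t ℕ.+ (u ℕ.+ u)) ² → t ² ℕ.≤ u ℕ.* (u ℕ.+ t)
    5²≤²⁻ u h = ℕ.*-cancelˡ-≤ 4 (ℕ.+-cancelˡ-≤ (t ²) _ _ (subst (5 ℕ.* t ² ℕ.≤_) (complete-square t u) h))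

    below-eq : ∀ u → T ℤ.- (+ (t ℕ.+ u) ℤ.+ + (t ℕ.+ u)) ≡ ℤ.- + (t ℕ.+ (u ℕ.+ u))
    below-eq u = eq T (+ u)
      where
      eq : ∀ x y → x ℤ.- ((x ℤ.+ y) ℤ.+ (x ℤ.+ y)) ≡ ℤ.- (x ℤ.+ (y ℤ.+ y))
      eq = ℤ-Solver.solve-∀

    above-eq : ∀ u → (+ (t ℕ.+ u) ℤ.+ + (t ℕ.+ u)) ℤ.- T ≡ + (t ℕ.+ (u ℕ.+ u))
    above-eq u = eq T (+ u)
      where
      eq : ∀ x y → ((x ℤ.+ y) ℤ.+ (x ℤ.+ y)) ℤ.- x ≡ x ℤ.+ (y ℤ.+ y)
      eq = ℤ-Solver.solve-∀

    0≰-pos : ∀ {k} → t ℕ.≤ k → ¬ (+ 0 ℤ.≤ ℤ.- + k)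
    0≰-pos {zero}  t≤0 = contradiction (ℕ.≤-antisym t≤0 z≤n) (ℕ.≢-nonZero⁻¹ t)
    0≰-pos {suc k} _   ()

    ∣a∣≤t : ∀ {a} → + 0 ℤ.≤ a → a ℤ.≤ T → ℤ.∣ a ∣ ℕ.≤ t
    ∣a∣≤t (ℤ.+≤+ _) (ℤ.+≤+ a≤t) = a≤t

    -- Because `k ≥ t > 0`, the first coordinate is negative and only the last case of `NonNegℤ`
    -- survives.
    nonNeg-below : ∀ {k} → t ℕ.≤ k → NonNegℤ (ℤ.- + k) T → k ² ℕ.≤ 5 ℕ.* t ²
    nonNeg-below t≤k (inj₁ (0≤-k , _))        = contradiction 0≤-k (0≰-pos t≤k)
    nonNeg-below t≤k (inj₂ (inj₁ (0≤-k , _))) = contradiction 0≤-k (0≰-pos t≤k)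
    nonNeg-below {k} t≤k (inj₂ (inj₂ (_ , le))) = subst (λ a → a ² ℕ.≤ 5 ℕ.* t ²) (ℤ.∣-i∣≡∣i∣ (+ k)) le

    nonNeg-above : ∀ {a} → NonNegℤ a (ℤ.- T) → + 0 ℤ.≤ a × 5 ℕ.* t ² ℕ.≤ ℤ.∣ a ∣ ²
    nonNeg-above     (inj₁ (_ , 0≤-t))        = contradiction 0≤-t (0≰-pos ℕ.≤-refl)
    nonNeg-above {a} (inj₂ (inj₁ (0≤a , le))) = 0≤a , subst (λ b → 5 ℕ.* b ² ℕ.≤ ℤ.∣ a ∣ ²) (ℤ.∣-i∣≡∣i∣ T) le
    nonNeg-above     (inj₂ (inj₂ (0≤-t , _))) = contradiction 0≤-t (0≰-pos ℕ.≤-refl)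

    T≤⇒∃ : ∀ {z} → T ℤ.≤ z → ∃ λ u → z ≡ + (t ℕ.+ u)
    T≤⇒∃ (ℤ.+≤+ t≤m) with ℕ.m≤n⇒∃[o]m+o≡n t≤m
    ... | u , refl = u , refl

  t+u≼φt⁺ : ∀ u → u ℕ.* (u ℕ.+ t) ℕ.≤ t ² → ι (+ (t ℕ.+ u)) ≼ φ ⊗ ι T
  t+u≼φt⁺ u h = ≼φ⁺ T (+ (t ℕ.+ u)) (subst (λ a → NonNegℤ a T) (sym (below-eq u))
    (inj₂ (inj₂ (ℤ.+≤+ z≤n , subst (λ a → a ² ℕ.≤ 5 ℕ.* t ²) (sym (ℤ.∣-i∣≡∣i∣ (+ (t ℕ.+ (u ℕ.+ u))))) (²≤5²⁺ u h)))))

  t+u≼φt⁻ : ∀ u → ι (+ (t ℕ.+ u)) ≼ φ ⊗ ι T → u ℕ.* (u ℕ.+ t) ℕ.≤ t ²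
  t+u≼φt⁻ u h = ²≤5²⁻ u (nonNeg-below (ℕ.m≤m+n t (u ℕ.+ u))
    (subst (λ a → NonNegℤ a T) (below-eq u) (≼φ⁻ T (+ (t ℕ.+ u)) h)))

  φt≼t+u⁺ : ∀ u → t ² ℕ.≤ u ℕ.* (u ℕ.+ t) → φ ⊗ ι T ≼ ι (+ (t ℕ.+ u))
  φt≼t+u⁺ u h = φ≼⁺ T (+ (t ℕ.+ u)) (subst (λ a → NonNegℤ a (ℤ.- T)) (sym (above-eq u))
    (inj₂ (inj₁ (ℤ.+≤+ z≤n , subst (λ a → 5 ℕ.* a ² ℕ.≤ (t ℕ.+ (u ℕ.+ u)) ²) (sym (ℤ.∣-i∣≡∣i∣ T)) (5²≤²⁺ u h)))))

  φt≼t+u⁻ : ∀ u → φ ⊗ ι T ≼ ι (+ (t ℕ.+ u)) → t ² ℕ.≤ u ℕ.* (u ℕ.+ t)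
  φt≼t+u⁻ u h = 5²≤²⁻ u (proj₂ (nonNeg-above
    (subst (λ a → NonNegℤ a (ℤ.- T)) (above-eq u) (φ≼⁻ T (+ (t ℕ.+ u)) h))))

  -- Shows that the floor is at least `t`, hence of the form `t + u`. If `t − 2z` is negative, its
  -- absolute value is at most `t`, so its square is at most `5t²`.
  ≤t⇒≼φt : ∀ z → z ℤ.≤ T → ι z ≼ φ ⊗ ι T
  ≤t⇒≼φt z z≤T = ≼φ⁺ T z (nonNeg (ℤ.≤-total (+ 0) (T ℤ.- (z ℤ.+ z))))
    where
    eq : ∀ x → ℤ.- (x ℤ.- (x ℤ.+ x)) ≡ x
    eq = ℤ-Solver.solve-∀
    -a≤T : ℤ.- (T ℤ.- (z ℤ.+ z)) ℤ.≤ T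
    -a≤T = subst (ℤ.- (T ℤ.- (z ℤ.+ z)) ℤ.≤_) (eq T)
      (ℤ.neg-mono-≤ (ℤ.+-monoʳ-≤ T (ℤ.neg-mono-≤ (ℤ.+-mono-≤ z≤T z≤T))))
    nonNeg : + 0 ℤ.≤ T ℤ.- (z ℤ.+ z) ⊎ T ℤ.- (z ℤ.+ z) ℤ.≤ + 0 → NonNegℤ (T ℤ.- (z ℤ.+ z)) T
    nonNeg (inj₁ 0≤a) = inj₁ (0≤a , ℤ.+≤+ z≤n)
    nonNeg (inj₂ a≤0) = inj₂ (inj₂ (ℤ.+≤+ z≤n , ℕ.≤-trans (ℕ.*-mono-≤ bound bound) (ℕ.m≤m+n (t ²) _)))
      where
      bound : ℤ.∣ T ℤ.- (z ℤ.+ z) ∣ ℕ.≤ t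
      bound = subst (ℕ._≤ t) (ℤ.∣-i∣≡∣i∣ (T ℤ.- (z ℤ.+ z))) (∣a∣≤t (ℤ.neg-mono-≤ a≤0) -a≤T)

  -- Shows that the ceiling exceeds `t`: from `z ≤ t` it would follow that `5t² ≤ (2z − t)² ≤ t²`.
  φt≼⇒≰t : ∀ z → φ ⊗ ι T ≼ ι z → ¬ (z ℤ.≤ T)
  φt≼⇒≰t z h z≤T = too-small (nonNeg-above (φ≼⁻ T z h))
    where
    0<4t² : 0 ℕ.< 4 ℕ.* t ²
    0<4t² = ℕ.*-mono-< {0} {4} (s≤s z≤n) (ℕ.*-mono-< (ℕ.>-nonZero⁻¹ t) (ℕ.>-nonZero⁻¹ t))
    eq : ∀ x → (x ℤ.+ x) ℤ.- x ≡ x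
    eq = ℤ-Solver.solve-∀
    too-small : ¬ (+ 0 ℤ.≤ z ℤ.+ z ℤ.- T × 5 ℕ.* t ² ℕ.≤ ℤ.∣ z ℤ.+ z ℤ.- T ∣ ²)
    too-small (0≤a , le) = ℕ.<⇒≱ (ℕ.m<m+n (t ²) {4 ℕ.* t ²} 0<4t²) (ℕ.≤-trans le (ℕ.*-mono-≤ bound bound))
      where
      bound : ℤ.∣ z ℤ.+ z ℤ.- T ∣ ℕ.≤ t
      bound = ∣a∣≤t 0≤a (subst (z ℤ.+ z ℤ.- T ℤ.≤_) (eq T) (ℤ.+-monoˡ-≤ (ℤ.- T) (ℤ.+-mono-≤ z≤T z≤T)))

  -- These are `z ≤ φt < z + 1` and `z − 1 < φt ≤ z`, squared out over the natural numbers. They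
  -- leave open whether `u` is `w` or `suc w`.
  IsFloor IsCeiling : ℤ → Set
  IsFloor   z = ∃ λ u → z ≡ + (t ℕ.+ u) × u ℕ.* (u ℕ.+ t) ℕ.≤ t ² × t ² ℕ.< suc u ℕ.* (suc u ℕ.+ t)
  IsCeiling z = ∃ λ w → z ≡ + (t ℕ.+ suc w) × t ² ℕ.≤ suc w ℕ.* (suc w ℕ.+ t) × w ℕ.* (w ℕ.+ t) ℕ.< t ²

  private
    isFloor : ∀ {z} → (∃ λ u → z ≡ + (t ℕ.+ u)) → ι z ≼ φ ⊗ ι T → ¬ (ι (ℤ.suc z) ≼ φ ⊗ ι T) → IsFloor z
    isFloor (u , refl) below above = u , refl , t+u≼φt⁻ u below , ℕ.≰⇒> λ h →
      above (subst (λ m → ι (+ m) ≼ φ ⊗ ι T) (ℕ.+-suc t u) (t+u≼φt⁺ (suc u) h))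

    isCeiling : ∀ {z} → (∃ λ w → ℤ.pred z ≡ + (t ℕ.+ w)) → φ ⊗ ι T ≼ ι z → ¬ (φ ⊗ ι T ≼ ι (ℤ.pred z)) → IsCeiling z
    isCeiling {z} (w , eq) above below = w , z≡ ,
      φt≼t+u⁻ (suc w) (subst (λ z → φ ⊗ ι T ≼ ι z) z≡ above) ,
      ℕ.≰⇒> λ h → below (subst (λ z → φ ⊗ ι T ≼ ι z) (sym eq) (φt≼t+u⁺ w h))
      where
      z≡ : z ≡ + (t ℕ.+ suc w)
      z≡ = trans (sym (ℤ.suc-pred z)) (trans (cong ℤ.suc eq) (cong +_ (sym (ℕ.+-suc t w))))

  ⌊φt⌋ : IsFloor ⌊ φ ⊗ ι T ⌋
  ⌊φt⌋ = isFloor (T≤⇒∃ (subst (T ℤ.≤_) (ℤ.pred-suc z) (ℤ.i<j⇒i≤pred[j] (ℤ.≰⇒> (above ∘ ≤t⇒≼φt (ℤ.suc z))))))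
                 (proj₁ (⌊⌋-spec (φ ⊗ ι T))) above
    where
    z = ⌊ φ ⊗ ι T ⌋
    above = proj₂ (⌊⌋-spec (φ ⊗ ι T))

  ⌈φt⌉ : IsCeiling ⌈ φ ⊗ ι T ⌉
  ⌈φt⌉ = isCeiling (T≤⇒∃ (ℤ.i<j⇒i≤pred[j] (ℤ.≰⇒> (φt≼⇒≰t ⌈ φ ⊗ ι T ⌉ above))))
                   above (proj₂ (⌈⌉-spec (φ ⊗ ι T)))
    where above = proj₁ (⌈⌉-spec (φ ⊗ ι T))

-- The cubic bound as an integer inequality

-- As `1/√5 = √5/5`, taking out the factor 1/5 makes both coordinates integers.
cube-bound : ∀ x y z → ((ι (+ 1) ⊕ √5) ⊗ ι x ⊕ (ι (+ 1) ⊕ 1/√5) ⊗ ι y) ⊕ ⊝ ι z ≡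
  ⟪ (+ 1 / 5) ℚ.* ((+ 5 ℤ.* (x ℤ.+ y ℤ.- z)) / 1) , (+ 1 / 5) ℚ.* ((+ 5 ℤ.* x ℤ.+ y) / 1) ⟫
cube-bound x y z = cong₂ ⟪_,_⟫
  (trans (solve 3 (λ a b c → (con 1ℚ :* a :+ con (+ 5 / 1) :* (con 1ℚ :* con 0ℚ)) :+
                             (con 1ℚ :* b :+ con (+ 5 / 1) :* (con (+ 1 / 5) :* con 0ℚ)) :+ (:- c) :=
                             con (+ 1 / 5) :* (con (+ 5 / 1) :* (a :+ b :+ (:- c))))
                refl (x / 1) (y / 1) (z / 1))
         (cong ((+ 1 / 5) ℚ.*_) (sym (trans (/1-* (+ 5) (x ℤ.+ y ℤ.- z)) (cong ((+ 5 / 1) ℚ.*_)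
           (trans (/1-+ (x ℤ.+ y) (ℤ.- z)) (cong₂ ℚ._+_ (/1-+ x y) (/1-neg z))))))))
  (trans (solve 2 (λ a b → (con 1ℚ :* con 0ℚ :+ con 1ℚ :* a) :+
                           (con 1ℚ :* con 0ℚ :+ con (+ 1 / 5) :* b) :+ (:- con 0ℚ) :=
                           con (+ 1 / 5) :* (con (+ 5 / 1) :* a :+ b))
                refl (x / 1) (y / 1))
         (cong ((+ 1 / 5) ℚ.*_) (sym (trans (/1-+ (+ 5 ℤ.* x) y) (cong (ℚ._+ y / 1) (/1-* (+ 5) x))))))
  where open ℚ-Solver.+-*-Solver

-- If `b` exceeds `t³ + t²`, let `k` be the excess. Then `k ≤ d`, and `(5k)² ≤ 5(5t³ + t²)²` is five
-- times the inequality for `d`.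
within⇒≼ : ∀ t b → Within t b →
  ι (+ b) ≼ (ι (+ 1) ⊕ √5) ⊗ ι ((+ t) ℤ.^ 3) ⊕ (ι (+ 1) ⊕ 1/√5) ⊗ ι ((+ t) ℤ.^ 2)
within⇒≼ t b (d , b≤ , 5d²≤) = subst₂ (λ x y → ι (+ b) ≼ (ι (+ 1) ⊕ √5) ⊗ ι x ⊕ (ι (+ 1) ⊕ 1/√5) ⊗ ι y)
  (sym T³) (sym T²) (subst NonNeg (sym (cube-bound (+ x) (+ y) (+ b))) (nonNeg-scale⁺ (+ 1 / 5) (+ 5 ℤ.* (+ x ℤ.+ + y ℤ.- + b)) (+ 5 ℤ.* + x ℤ.+ + y) nonNeg))
  where
  x y : ℕ
  x = t ℕ.* t ²
  y = t ²

  T² : (+ t) ℤ.^ 2 ≡ + y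
  T² = trans (cong (+ t ℤ.*_) (ℤ.*-identityʳ (+ t))) (sym (ℤ.pos-* t t))

  T³ : (+ t) ℤ.^ 3 ≡ + x
  T³ = trans (cong (+ t ℤ.*_) T²) (sym (ℤ.pos-* t y))

  5x+y : + 5 ℤ.* + x ℤ.+ + y ≡ + (5 ℕ.* x ℕ.+ y)
  5x+y = cong (ℤ._+ + y) (sym (ℤ.pos-* 5 x))

  W≡ : t ² ℕ.* (5 ℕ.* t ℕ.+ 1) ≡ 5 ℕ.* x ℕ.+ y
  W≡ = eq t
    where
    eq : ∀ t → t ℕ.* t ℕ.* (5 ℕ.* t ℕ.+ 1) ≡ 5 ℕ.* (t ℕ.* (t ℕ.* t)) ℕ.+ t ℕ.* t
    eq = solve-∀

  nonNeg : NonNegℤ (+ 5 ℤ.* (+ x ℤ.+ + y ℤ.- + b)) (+ 5 ℤ.* + x ℤ.+ + y)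
  nonNeg with ℕ.≤-total b (x ℕ.+ y)
  ... | inj₁ b≤x+y = inj₁ (ℤ.*-monoˡ-≤-nonNeg (+ 5) (ℤ.i≤j⇒0≤j-i (ℤ.+≤+ b≤x+y)) ,
          subst (+ 0 ℤ.≤_) (sym 5x+y) (ℤ.+≤+ z≤n))
  ... | inj₂ x+y≤b with ℕ.m≤n⇒∃[o]m+o≡n x+y≤b
  ...   | k , refl = inj₂ (inj₂ (subst (+ 0 ℤ.≤_) (sym 5x+y) (ℤ.+≤+ z≤n) , (begin
      ℤ.∣ + 5 ℤ.* (+ x ℤ.+ + y ℤ.- + (x ℕ.+ y ℕ.+ k)) ∣ ²   ≡⟨ cong _² ∣a∣ ⟩
      (5 ℕ.* k) ²                                           ≡⟨ eq k ⟩
      5 ℕ.* (5 ℕ.* k ²)                                     ≤⟨ ℕ.*-monoʳ-≤ 5 (ℕ.*-monoʳ-≤ 5 (ℕ.*-mono-≤ k≤d k≤d)) ⟩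
      5 ℕ.* (5 ℕ.* d ²)                                     ≤⟨ ℕ.*-monoʳ-≤ 5 5d²≤ ⟩
      5 ℕ.* (t ² ℕ.* (5 ℕ.* t ℕ.+ 1)) ²                     ≡⟨ cong (λ w → 5 ℕ.* w ²) W≡ ⟩
      5 ℕ.* (5 ℕ.* x ℕ.+ y) ²                               ≡⟨ cong (λ w → 5 ℕ.* ℤ.∣ w ∣ ²) 5x+y ⟨
      5 ℕ.* ℤ.∣ + 5 ℤ.* + x ℤ.+ + y ∣ ²                     ∎)))
    where
    open ℕ.≤-Reasoning
    k≤d : k ℕ.≤ d
    k≤d = ℕ.+-cancelˡ-≤ (x ℕ.+ y) k d b≤
    eq : ∀ k → (5 ℕ.* k) ℕ.* (5 ℕ.* k) ≡ 5 ℕ.* (5 ℕ.* (k ℕ.* k))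
    eq = solve-∀
    minus : ∀ a k → + 5 ℤ.* (a ℤ.- (a ℤ.+ k)) ≡ ℤ.- (+ 5 ℤ.* k)
    minus = ℤ-Solver.solve-∀
    ∣a∣ : ℤ.∣ + 5 ℤ.* (+ x ℤ.+ + y ℤ.- + (x ℕ.+ y ℕ.+ k)) ∣ ≡ 5 ℕ.* k
    ∣a∣ = trans (cong ℤ.∣_∣ (minus (+ (x ℕ.+ y)) (+ k)))
         (trans (ℤ.∣-i∣≡∣i∣ (+ 5 ℤ.* + k)) (ℤ.abs-* (+ 5) (+ k)))

-- The bounds on f

-- With `k = n − 3t − 2p`, the blocks `X` have sizes `x = p + t + k` and `y = 3t + k`; the condition
-- on `n` amounts to `p + t ≤ x`.
f≤2pe : ∀ {n t p} (E : ℕ → ℕ → Bool) → 3 ℕ.* t ℕ.+ 2 ℕ.* p ℕ.≤ n →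
  (∀ i → i ℕ.< p ℕ.+ t → t ℕ.+ t ℕ.≤ p ℕ.+ ∑ t (λ j → ⟦ E i j ⟧)) →
  (∀ j → j ℕ.< t → t ℕ.≤ ∑ (p ℕ.+ t) (λ i → ⟦ E i j ⟧)) →
  f n t ℕ.≤ 2 ℕ.* (p ℕ.* ∑ (p ℕ.+ t) (λ i → ∑ t (λ j → ⟦ E i j ⟧)))
f≤2pe {n} {t} {p} E n≥ row col with ℕ.m≤n⇒∃[o]m+o≡n n≥
... | k , refl = Construction.f-bound n t p (p ℕ.+ t ℕ.+ k) (3 ℕ.* t ℕ.+ k) E
      (eq₁ t p k) (eq₃ t p k) (ℕ.m≤m+n (p ℕ.+ t) k) row col
  where
  eq₁ : ∀ t p k → 3 ℕ.* t ℕ.+ 2 ℕ.* p ℕ.+ k ≡ p ℕ.+ t ℕ.+ (t ℕ.+ (p ℕ.+ t ℕ.+ k))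
  eq₁ = solve-∀
  eq₃ : ∀ t p k → 3 ℕ.* t ℕ.+ 2 ℕ.* p ℕ.+ k ≡ p ℕ.+ (p ℕ.+ (3 ℕ.* t ℕ.+ k))
  eq₃ = solve-∀

module _ {n t u s} .{{_ : NonZero t}} (t≡u+s : t ≡ u ℕ.+ s) (n≥ : 3 ℕ.* t ℕ.+ 2 ℕ.* (t ℕ.+ u) ℕ.≤ n) where

  private
    p : ℕ
    p = t ℕ.+ u

    2t≡p+s : t ℕ.+ t ≡ p ℕ.+ s
    2t≡p+s = trans (cong (t ℕ.+_) t≡u+s) (sym (ℕ.+-assoc t u s))

  -- Every vertex of `A` gets exactly its required degree `s = 2t − p`; balancing then gives each
  -- vertex of `B` at least `t`.
  f≤2p[p+t][2t∸p] : t ² ℕ.≤ (p ℕ.+ t) ℕ.* s → f n t ℕ.≤ 2 ℕ.* (p ℕ.* ((p ℕ.+ t) ℕ.* s))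
  f≤2p[p+t][2t∸p] h with balanced (p ℕ.+ t) t s t (subst (s ℕ.≤_) (sym t≡u+s) (ℕ.m≤n+m s u)) h
  ... | E , row , col = subst (λ e → f n t ℕ.≤ 2 ℕ.* (p ℕ.* e))
        (trans (∑-cong (p ℕ.+ t) (λ i _ → row i)) (∑-const (p ℕ.+ t) s))
        (f≤2pe E n≥ (λ i _ → ℕ.≤-reflexive (trans 2t≡p+s (cong (p ℕ.+_) (sym (row i))))) col)

  -- The transposed choice: every vertex of `B` gets exactly `t`, and balancing gives each vertex of
  -- `A` at least `s`.
  f≤2pt² : (p ℕ.+ t) ℕ.* s ℕ.≤ t ² → f n t ℕ.≤ 2 ℕ.* (p ℕ.* t ²)
  f≤2pt² h with balanced t (p ℕ.+ t) t s {{ℕ.>-nonZero (ℕ.≤-trans (ℕ.>-nonZero⁻¹ t) (ℕ.m≤n+m t p))}}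
                  (ℕ.m≤n+m t p) (subst (ℕ._≤ t ²) (ℕ.*-comm (p ℕ.+ t) s) h)
  ... | E , row , col = subst (λ e → f n t ℕ.≤ 2 ℕ.* (p ℕ.* e))
        (trans (∑-comm ℕ.+-0-commutativeMonoid {p ℕ.+ t} {t} (λ i j → ⟦ E (toℕ j) (toℕ i) ⟧))
        (trans (∑-cong t (λ j _ → row j)) (∑-const t t)))
        (f≤2pe (flip E) n≥
          (λ i i<p+t → ℕ.≤-trans (ℕ.≤-reflexive 2t≡p+s) (ℕ.+-monoʳ-≤ p (col i i<p+t)))
          (λ j _ → ℕ.≤-reflexive (sym (row j))))

-- Combining the floor and the ceiling

cost : ℕ → ℤ → ℤ
cost t p = p * (((+ t) ^ 2) ⊔ ((p + + t) * (+ 2 * + t - p)))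

cost-ℕ : ∀ t u s → t ≡ u ℕ.+ s → cost t (+ (t ℕ.+ u)) ≡ + ((t ℕ.+ u) ℕ.* (t ² ℕ.⊔ ((t ℕ.+ u ℕ.+ t) ℕ.* s)))
cost-ℕ t u s t≡u+s = trans (cong (+ (t ℕ.+ u) *_) (cong₂ _⊔_ T² product)) (sym (ℤ.pos-* (t ℕ.+ u) _))
  where
  T² : (+ t) ^ 2 ≡ + t ²
  T² = trans (cong (+ t *_) (ℤ.*-identityʳ (+ t))) (sym (ℤ.pos-* t t))
  lemma : ∀ u s → + 2 * (u + s) - ((u + s) + u) ≡ s
  lemma = ℤ-Solver.solve-∀
  diff : + 2 * + t - + (t ℕ.+ u) ≡ + s
  diff = subst (λ t → + 2 * + t - + (t ℕ.+ u) ≡ + s) (sym t≡u+s) (lemma (+ u) (+ s))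
  product : (+ (t ℕ.+ u) + + t) * (+ 2 * + t - + (t ℕ.+ u)) ≡ + ((t ℕ.+ u ℕ.+ t) ℕ.* s)
  product = trans (cong (+ (t ℕ.+ u ℕ.+ t) *_) diff) (sym (ℤ.pos-* (t ℕ.+ u ℕ.+ t) s))

Bounds : ℕ → ℕ → ℤ → Set
Bounds t n b = (+ f n t ≤ b) × (ι b ≼ (ι (+ 1) ⊕ √5) ⊗ ι ((+ t) ^ 3) ⊕ (ι (+ 1) ⊕ 1/√5) ⊗ ι ((+ t) ^ 2))

module _ {t n u s w r : ℕ} .{{_ : NonZero t}} (t≡u+s : t ≡ u ℕ.+ s) (t≡1+w+r : t ≡ suc w ℕ.+ r)
  (u-below : u ℕ.* (u ℕ.+ t) ℕ.≤ t ²) (1+u-above : t ² ℕ.< suc u ℕ.* (suc u ℕ.+ t))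
  (1+w-above : t ² ℕ.≤ suc w ℕ.* (suc w ℕ.+ t)) (w-below : w ℕ.* (w ℕ.+ t) ℕ.< t ²)
  (n≥₂ : 3 ℕ.* t ℕ.+ 2 ℕ.* (t ℕ.+ suc w) ℕ.≤ n) where

  private
    -- Since `t + w < φt < t + u + 1`, the ceiling is at most one above the floor.
    w≤u : w ℕ.≤ u
    w≤u = ℕ.≤-pred (rising-cancel-< t (ℕ.<-trans w-below 1+u-above))

    u≤1+w : u ℕ.≤ suc w
    u≤1+w = ℕ.≮⇒≥ λ 1+w<u → ℕ.<⇒≱ (ℕ.*-mono-< 1+w<u (ℕ.+-monoˡ-< t 1+w<u)) (ℕ.≤-trans u-below 1+w-above)

    C₁ C₂ : ℕ
    C₁ = (t ℕ.+ u) ℕ.* ((t ℕ.+ u ℕ.+ t) ℕ.* s)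
    C₂ = (t ℕ.+ suc w) ℕ.* t ²

    n≥₁ : 3 ℕ.* t ℕ.+ 2 ℕ.* (t ℕ.+ u) ℕ.≤ n
    n≥₁ = ℕ.≤-trans (ℕ.+-monoʳ-≤ (3 ℕ.* t) (ℕ.*-monoʳ-≤ 2 (ℕ.+-monoʳ-≤ t u≤1+w))) n≥₂

    max₁ : t ² ℕ.≤ (t ℕ.+ u ℕ.+ t) ℕ.* s
    max₁ = t²≤[p+t][2t∸p] t≡u+s u-below

    max₂ : (t ℕ.+ suc w ℕ.+ t) ℕ.* r ℕ.≤ t ²
    max₂ = [p+t][2t∸p]≤t² t≡1+w+r 1+w-above

    bound≡ : + 2 * (cost t (+ (t ℕ.+ u)) ⊓ cost t (+ (t ℕ.+ suc w))) ≡ + (2 ℕ.* (C₁ ℕ.⊓ C₂))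
    bound≡ = trans (cong (+ 2 *_) (cong₂ _⊓_
        (trans (cost-ℕ t u s t≡u+s) (cong (λ m → + ((t ℕ.+ u) ℕ.* m)) (ℕ.m≤n⇒m⊔n≡n max₁)))
        (trans (cost-ℕ t (suc w) r t≡1+w+r) (cong (λ m → + ((t ℕ.+ suc w) ℕ.* m)) (ℕ.m≥n⇒m⊔n≡m max₂)))))
      (sym (ℤ.pos-* 2 (C₁ ℕ.⊓ C₂)))

    f≤ : f n t ℕ.≤ 2 ℕ.* (C₁ ℕ.⊓ C₂)
    f≤ = subst (f n t ℕ.≤_) (sym (ℕ.*-distribˡ-⊓ 2 C₁ C₂))
      (ℕ.⊓-glb (f≤2p[p+t][2t∸p] t≡u+s n≥₁ max₁) (f≤2pt² t≡1+w+r n≥₂ max₂))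

    weaken : ∀ {b c} → b ℕ.≤ c → Within t c → Within t b
    weaken b≤c (d , c≤ , h) = d , ℕ.≤-trans b≤c c≤ , h

    -- The first bound holds for both costs, whereas the second needs only one of them; the test
    -- decides whether `v > u`.
    within : Dec (suc (u ℕ.* (u ℕ.+ t) ℕ.+ u) ℕ.≤ t ²) → Within t (2 ℕ.* (C₁ ℕ.⊓ C₂))
    within (yes far) = weaken (ℕ.*-monoʳ-≤ 2 (ℕ.m⊓n≤n C₁ C₂)) (ceiling-within t u (suc w) (s≤s w≤u) far)
    within (no ¬far) = weaken (ℕ.*-monoʳ-≤ 2 (ℕ.m⊓n≤m C₁ C₂)) (floor-within t u s t≡u+s u-below (ℕ.≮⇒≥ ¬far))

  bounds : Bounds t n (+ 2 * (cost t (+ (t ℕ.+ u)) ⊓ cost t (+ (t ℕ.+ suc w))))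
  bounds = subst (Bounds t n) (sym bound≡)
    (ℤ.+≤+ f≤ , within⇒≼ t (2 ℕ.* (C₁ ℕ.⊓ C₂)) (within (suc (u ℕ.* (u ℕ.+ t) ℕ.+ u) ℕ.≤? t ²)))

floor-ceiling-bounds : ∀ t n .{{_ : NonZero t}} {p₁ p₂} → IsFloor t p₁ → IsCeiling t p₂ →
  + 3 * + t + + 2 * p₂ ≤ + n → Bounds t n (+ 2 * (cost t p₁ ⊓ cost t p₂))
floor-ceiling-bounds t n (u , refl , below , above) (w , refl , above′ , below′) n≥
  with ℕ.m≤n⇒∃[o]m+o≡n (rising-≤⇒≤ t u below)
     -- From `w(w + t) < t² ≤ t(t + t)` follows `w < t`, so the ceiling is at most `2t` too.
     | ℕ.m≤n⇒∃[o]m+o≡n (rising-cancel-< t {w} {t} (ℕ.<-≤-trans below′ (ℕ.*-monoʳ-≤ t (ℕ.m≤m+n t t))))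
... | s , u+s≡t | r , 1+w+r≡t = bounds (sym u+s≡t) (sym 1+w+r≡t) below above above′ below′
  (ℤ.drop‿+≤+ (subst (_≤ + n) (sym (cong₂ _+_ (ℤ.pos-* 3 t) (ℤ.pos-* 2 (t ℕ.+ suc w)))) n≥))

theorem1p3 : (t n : ℕ) → 1 ℕ.≤ t →
    let T = + t
        p₁ = ⌊ φ ⊗ ι T ⌋
        p₂ = ⌈ φ ⊗ ι T ⌉
        cost = λ (p : ℤ) → p * ((T ^ 2) ⊔ ((p + T) * (+ 2 * T - p)))
        bound = + 2 * (cost p₁ ⊓ cost p₂)
    in
    + n ≥ + 3 * T + + 2 * p₂ →
    (+ f n t ≤ bound) ×
    (ι bound ≼ (ι (+ 1) ⊕ √5) ⊗ ι (T ^ 3) ⊕ (ι (+ 1) ⊕ 1/√5) ⊗ ι (T ^ 2))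
theorem1p3 t n 1≤t = floor-ceiling-bounds t n (⌊φt⌋ t) (⌈φt⌉ t)
  where
  instance
    t≢0 : NonZero t
    t≢0 = ℕ.>-nonZero 1≤t
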